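{- Let $V$ be a finite set of size $n$, let $k$ be an integer with $0\le 2k\le n$, and let $t\in\{1,\ldots,k-1\}$. Let $I,J\subseteq V$ be disjoint of size $i=\#I$ and $j=\#J$, and suppose that the paired function $p_{I,J}:\binom{V}{k}\to\mathbb{R}$ has degree $t$. Then $p_{I,J}$ is smaller than a $t$-pencil (i.e. $\#p_{I,J}<\binom{n-t}{k-t}$) precisely in the following cases: (i) $t$ is even and $n=2k$ and $\{i,j\}=\{t+1,0\}$, where $\#p_{I,J}=2\binom{2k-t-1}{k}$. If additionally $k=t+1$ (where $\#p_{I,J}=2$), then there are the alternative representations $\{i,j\}=\{t+1,\ell\}$ with $\ell\in\{0,\ldots,t+1\}$ (which also belong to this case). (ii) $t$ is even and $n=2k$ and $k=t+1$ and $i,j\in\{1,\ldots,k-1\}$ with $i+j>k$ and $\binom{2k-i-j}{k-i}<\frac{k+1}{2}$, where $\#p_{I,J}=2\binom{2k-i-j}{k-i}$. Moreover, $p_{I,J}$ has the same size as a $t$-pencil (i.e. $\#p_{I,J}=\binom{n-t}{k-t}$) precisely in the following cases: (iii) $t$ is even and $t\le k$ and $n=2k+1$ and $\{i,j\}=\{t+1,0\}$. (iv) $t$ is even and $n=2k$ and $k=t+1$ and $i,j\in\{1,\ldots,k-1\}$ with $i+j\ge k$ and $\binom{2k-i-j}{k-i}=\frac{k+1}{2}$.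
   Context: $\binom{V}{k}$ is the set of all $k$-element subsets of $V$; $A^\complement=V\setminus A$. For $A\subseteq B\subseteq V$, the basic function $f_{A,B}:\binom{V}{k}\to\mathbb{R}$ is the characteristic function of $\{K\in\binom{V}{k}\mid A\subseteq K\subseteq B\}$. For disjoint $I,J\subseteq V$, the paired function is $p_{I,J}=f_{I,J^\complement}+f_{J,I^\complement}$. For $T\subseteq V$ with $\#T=t$, the function $f_{T,V}$ is called a $t$-pencil. The size of $f:\binom{V}{k}\to\mathbb{R}$ is $\#f=\sum_{K\in\binom{V}{k}}f(K)$; a $t$-pencil has size $\binom{n-t}{k-t}$. The degree of a non-zero function $f:\binom{V}{k}\to\mathbb{R}$ is the smallest $t$ such that $f$ is an $\mathbb{R}$-linear combination of $t$-pencils; the degree of the zero function is $-\infty$. -}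

module Defs where

open import Data.Bool using (if_then_else_)
open import Data.Fin.Subset
  using (Subset; inside; outside; _∩_; _⊆_; ∁; ⊤; ∣_∣; Empty)
open import Data.Fin.Subset.Properties using (_⊆?_)
open import Data.Integer using (+_)
open import Data.List using (List; []; _∷_; _++_; map; foldr)
open import Data.Nat as ℕ using (ℕ; zero; suc)
open import Data.Nat.Combinatorics using (_C_)
open import Data.Nat.Divisibility using (_∣_)
import Data.Nat.Properties as ℕ
open import Data.Product using (Σ-syntax; ∃-syntax; _×_; _,_; proj₁)
open import Data.Rational as ℚ using (ℚ; 0ℚ; 1ℚ; ½)
import Data.Rational.Properties as ℚ
open import Data.Rational.Solver using (module +-*-Solver)
open import Data.Sum using (_⊎_)
import Data.Vec as Vec
open import Relation.Binary.PropositionalEquality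
  using (_≡_; refl; sym; trans; cong; cong₂; subst)
open import Relation.Nullary using (¬_; does; _×-dec_)
open import Relation.Nullary.Construct.Add.Infimum using (_₋; ⊥₋; [_])

-- Real numbers, as Cauchy sequences of rationals.  ℝ is used as a setoid
-- under _≈_.

dist : ℚ → ℚ → ℚ
dist p q = ℚ.∣ p ℚ.- q ∣

IsCauchy : (ℕ → ℚ) → Set
IsCauchy s = ∀ ε → 0ℚ ℚ.< ε →
  ∃[ N ] (∀ m n → N ℕ.≤ m → N ℕ.≤ n → dist (s m) (s n) ℚ.< ε)

record ℝ : Set where
  constructor mkℝ
  field
    seq    : ℕ → ℚ
    cauchy : IsCauchy seq

open ℝ public

infix 4 _≈_ _<ℝ_

_≈_ : ℝ → ℝ → Set
x ≈ y = ∀ ε → 0ℚ ℚ.< ε →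
  ∃[ N ] (∀ n → N ℕ.≤ n → dist (seq x n) (seq y n) ℚ.< ε)

-- The sequences must be eventually separated by a fixed positive rational;
-- an eventual termwise strict inequality would not respect _≈_.
_<ℝ_ : ℝ → ℝ → Set
x <ℝ y = Σ[ ε ∈ ℚ ] (0ℚ ℚ.< ε ×
  ∃[ N ] (∀ n → N ℕ.≤ n → seq x n ℚ.+ ε ℚ.< seq y n))

module CauchyBounds where

  open +-*-Solver using (solve; _:+_; _:-_; _:*_; _:=_)

  0<½ : 0ℚ ℚ.< ½
  0<½ = ℚ.positive⁻¹ ½

  ½ε+½ε : ∀ ε → ε ℚ.* ½ ℚ.+ ε ℚ.* ½ ≡ ε
  ½ε+½ε ε = trans (sym (ℚ.*-distribˡ-+ ε ½ ½)) (ℚ.*-identityʳ ε)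

  0<* : ∀ {p q} → 0ℚ ℚ.< p → 0ℚ ℚ.< q → 0ℚ ℚ.< p ℚ.* q
  0<* {p} {q} 0<p 0<q = subst (ℚ._< p ℚ.* q) (ℚ.*-zeroʳ p)
    (ℚ.*-monoʳ-<-pos p {{ℚ.positive 0<p}} 0<q)

  dist-+ : ∀ a b c d → dist (a ℚ.+ b) (c ℚ.+ d) ℚ.≤ dist a c ℚ.+ dist b d
  dist-+ a b c d =
    subst (λ z → ℚ.∣ z ∣ ℚ.≤ dist a c ℚ.+ dist b d) (eq a b c d)
      (ℚ.∣p+q∣≤∣p∣+∣q∣ (a ℚ.- c) (b ℚ.- d))
    where
    eq : ∀ a b c d →
      (a ℚ.- c) ℚ.+ (b ℚ.- d) ≡ (a ℚ.+ b) ℚ.- (c ℚ.+ d)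
    eq =
      solve 4 (λ a b c d → (a :- c) :+ (b :- d) := (a :+ b) :- (c :+ d)) refl

  dist-* : ∀ a b c d →
    dist (a ℚ.* b) (c ℚ.* d) ℚ.≤ ℚ.∣ a ∣ ℚ.* dist b d ℚ.+ ℚ.∣ d ∣ ℚ.* dist a c
  dist-* a b c d = begin
    ℚ.∣ a ℚ.* b ℚ.- c ℚ.* d ∣
      ≡⟨ cong ℚ.∣_∣ (eq a b c d) ⟩
    ℚ.∣ a ℚ.* (b ℚ.- d) ℚ.+ d ℚ.* (a ℚ.- c) ∣
      ≤⟨ ℚ.∣p+q∣≤∣p∣+∣q∣ (a ℚ.* (b ℚ.- d)) (d ℚ.* (a ℚ.- c)) ⟩
    ℚ.∣ a ℚ.* (b ℚ.- d) ∣ ℚ.+ ℚ.∣ d ℚ.* (a ℚ.- c) ∣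
      ≡⟨ cong₂ ℚ._+_ (ℚ.∣p*q∣≡∣p∣*∣q∣ a (b ℚ.- d)) (ℚ.∣p*q∣≡∣p∣*∣q∣ d (a ℚ.- c)) ⟩
    ℚ.∣ a ∣ ℚ.* dist b d ℚ.+ ℚ.∣ d ∣ ℚ.* dist a c ∎
    where
    open ℚ.≤-Reasoning
    eq : ∀ a b c d →
      a ℚ.* b ℚ.- c ℚ.* d ≡ a ℚ.* (b ℚ.- d) ℚ.+ d ℚ.* (a ℚ.- c)
    eq =
      solve 4 (λ a b c d → a :* b :- c :* d := a :* (b :- d) :+ d :* (a :- c)) refl

  eventuallyBounded : ∀ s → IsCauchy s →
    ∃[ N ] Σ[ B ∈ ℚ ] (0ℚ ℚ.< B × (∀ n → N ℕ.≤ n → ℚ.∣ s n ∣ ℚ.≤ B))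
  eventuallyBounded s c with c 1ℚ (ℚ.positive⁻¹ 1ℚ)
  ... | N , close = N , 1ℚ ℚ.+ ℚ.∣ s N ∣ , positive , bound
    where
    positive : 0ℚ ℚ.< 1ℚ ℚ.+ ℚ.∣ s N ∣
    positive = ℚ.+-mono-<-≤ (ℚ.positive⁻¹ 1ℚ) (ℚ.0≤∣p∣ (s N))

    eq : ∀ a b → (a ℚ.- b) ℚ.+ b ≡ a
    eq =
      solve 2 (λ a b → (a :- b) :+ b := a) refl

    bound : ∀ n → N ℕ.≤ n → ℚ.∣ s n ∣ ℚ.≤ 1ℚ ℚ.+ ℚ.∣ s N ∣
    bound n N≤n = begin
      ℚ.∣ s n ∣                        ≡⟨ cong ℚ.∣_∣ (sym (eq (s n) (s N))) ⟩
      ℚ.∣ (s n ℚ.- s N) ℚ.+ s N ∣      ≤⟨ ℚ.∣p+q∣≤∣p∣+∣q∣ (s n ℚ.- s N) (s N) ⟩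
      dist (s n) (s N) ℚ.+ ℚ.∣ s N ∣
        ≤⟨ ℚ.+-monoˡ-≤ ℚ.∣ s N ∣ (ℚ.<⇒≤ (close n N N≤n ℕ.≤-refl)) ⟩
      1ℚ ℚ.+ ℚ.∣ s N ∣                 ∎
      where open ℚ.≤-Reasoning

  shrink : ∀ B → 0ℚ ℚ.< B → ∀ ε → 0ℚ ℚ.< ε →
    Σ[ δ ∈ ℚ ] (0ℚ ℚ.< δ × B ℚ.* δ ≡ ε)
  shrink B 0<B ε 0<ε = ε ℚ.* 1/B , 0<* 0<ε 0<1/B , eq
    where
    instance
      B-pos : ℚ.Positive B
      B-pos = ℚ.positive 0<B
      B≢0 : ℚ.NonZero B
      B≢0 = ℚ.pos⇒nonZero B
    1/B = ℚ.1/ B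
    0<1/B : 0ℚ ℚ.< 1/B
    0<1/B = ℚ.positive⁻¹ 1/B {{ℚ.1/pos⇒pos B}}
    rearrange : ∀ b e i → b ℚ.* (e ℚ.* i) ≡ e ℚ.* (b ℚ.* i)
    rearrange =
      solve 3 (λ b e i → b :* (e :* i) := e :* (b :* i)) refl
    eq : B ℚ.* (ε ℚ.* 1/B) ≡ ε
    eq = trans (rearrange B ε 1/B)
      (trans (cong (ε ℚ.*_) (ℚ.*-inverseʳ B)) (ℚ.*-identityʳ ε))

  *-bound : ∀ {a b B δ} → 0ℚ ℚ.< B → a ℚ.≤ B → 0ℚ ℚ.≤ b → b ℚ.< δ →
    a ℚ.* b ℚ.< B ℚ.* δ
  *-bound {a} {b} {B} {δ} 0<B a≤B 0≤b b<δ = ℚ.≤-<-trans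
    (ℚ.*-monoʳ-≤-nonNeg b {{ℚ.nonNegative 0≤b}} a≤B)
    (ℚ.*-monoʳ-<-pos B {{ℚ.positive 0<B}} b<δ)

  ⊔-left : ∀ M N {m} → M ℕ.⊔ N ℕ.≤ m → M ℕ.≤ m
  ⊔-left M N = ℕ.≤-trans (ℕ.m≤m⊔n M N)

  ⊔-right : ∀ M N {m} → M ℕ.⊔ N ℕ.≤ m → N ℕ.≤ m
  ⊔-right M N = ℕ.≤-trans (ℕ.m≤n⊔m M N)

  +-close : ∀ a b c d ε → dist a c ℚ.< ε ℚ.* ½ → dist b d ℚ.< ε ℚ.* ½ →
    dist (a ℚ.+ b) (c ℚ.+ d) ℚ.< ε
  +-close a b c d ε p q = ℚ.≤-<-trans (dist-+ a b c d)
    (subst (dist a c ℚ.+ dist b d ℚ.<_) (½ε+½ε ε) (ℚ.+-mono-< p q))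

  *-close : ∀ a b c d ε {A D β α} → 0ℚ ℚ.< A → 0ℚ ℚ.< D →
    ℚ.∣ a ∣ ℚ.≤ A → ℚ.∣ d ∣ ℚ.≤ D →
    A ℚ.* β ≡ ε ℚ.* ½ → D ℚ.* α ≡ ε ℚ.* ½ →
    dist b d ℚ.< β → dist a c ℚ.< α →
    dist (a ℚ.* b) (c ℚ.* d) ℚ.< ε
  *-close a b c d ε 0<A 0<D a≤A d≤D Aβ Dα p q = ℚ.≤-<-trans (dist-* a b c d)
    (subst (ℚ.∣ a ∣ ℚ.* dist b d ℚ.+ ℚ.∣ d ∣ ℚ.* dist a c ℚ.<_)
      (trans (cong₂ ℚ._+_ Aβ Dα) (½ε+½ε ε))
      (ℚ.+-mono-< (*-bound 0<A a≤A (ℚ.0≤∣p∣ (b ℚ.- d)) p)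
                  (*-bound 0<D d≤D (ℚ.0≤∣p∣ (a ℚ.- c)) q)))

  +-cauchy : ∀ r s → IsCauchy r → IsCauchy s → IsCauchy (λ n → r n ℚ.+ s n)
  +-cauchy r s cr cs ε 0<ε =
    let M , closeʳ = cr (ε ℚ.* ½) (0<* 0<ε 0<½)
        N , closeˢ = cs (ε ℚ.* ½) (0<* 0<ε 0<½)
    in M ℕ.⊔ N , λ m n p q →
      +-close (r m) (s m) (r n) (s n) ε
        (closeʳ m n (⊔-left M N p) (⊔-left M N q))
        (closeˢ m n (⊔-right M N p) (⊔-right M N q))

  *-cauchy : ∀ r s → IsCauchy r → IsCauchy s → IsCauchy (λ n → r n ℚ.* s n)
  *-cauchy r s cr cs ε 0<ε =
    let Nʳ , Bʳ , 0<Bʳ , boundʳ = eventuallyBounded r cr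
        Nˢ , Bˢ , 0<Bˢ , boundˢ = eventuallyBounded s cs
        δˢ , 0<δˢ , eqˢ = shrink Bʳ 0<Bʳ (ε ℚ.* ½) (0<* 0<ε 0<½)
        δʳ , 0<δʳ , eqʳ = shrink Bˢ 0<Bˢ (ε ℚ.* ½) (0<* 0<ε 0<½)
        Mʳ , closeʳ = cr δʳ 0<δʳ
        Mˢ , closeˢ = cs δˢ 0<δˢ
        N = Nʳ ℕ.⊔ Nˢ
        M = Mʳ ℕ.⊔ Mˢ
    in N ℕ.⊔ M , λ m n p q →
      *-close (r m) (s m) (r n) (s n) ε 0<Bʳ 0<Bˢ
        (boundʳ m (⊔-left Nʳ Nˢ (⊔-left N M p)))
        (boundˢ n (⊔-right Nʳ Nˢ (⊔-left N M q)))
        eqˢ eqʳ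
        (closeˢ m n (⊔-right Mʳ Mˢ (⊔-right N M p))
                    (⊔-right Mʳ Mˢ (⊔-right N M q)))
        (closeʳ m n (⊔-left Mʳ Mˢ (⊔-right N M p))
                    (⊔-left Mʳ Mˢ (⊔-right N M q)))

open CauchyBounds

infixl 6 _+ℝ_
infixl 7 _*ℝ_

_+ℝ_ : ℝ → ℝ → ℝ
x +ℝ y = mkℝ (λ n → seq x n ℚ.+ seq y n)
             (+-cauchy (seq x) (seq y) (cauchy x) (cauchy y))

_*ℝ_ : ℝ → ℝ → ℝ
x *ℝ y = mkℝ (λ n → seq x n ℚ.* seq y n)
             (*-cauchy (seq x) (seq y) (cauchy x) (cauchy y))

fromℚ : ℚ → ℝ
fromℚ q = mkℝ (λ _ → q) λ ε 0<ε →
  0 , λ _ _ _ _ → subst (ℚ._< ε) (cong ℚ.∣_∣ (sym (ℚ.+-inverseʳ q))) 0<ε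

fromℕ : ℕ → ℝ
fromℕ m = fromℚ (+ m ℚ./ 1)

0ℝ 1ℝ : ℝ
0ℝ = fromℕ 0
1ℝ = fromℕ 1

∑ : ∀ {A : Set} → List A → (A → ℝ) → ℝ
∑ xs f = foldr (λ x acc → f x +ℝ acc) 0ℝ xs

-- The ground set V is Fin n.

KSubset : ℕ → ℕ → Set
KSubset n k = Σ[ K ∈ Subset n ] ∣ K ∣ ≡ k

Fun : ℕ → ℕ → Set
Fun n k = KSubset n k → ℝ

infix 4 _≗ℝ_

_≗ℝ_ : ∀ {n k} → Fun n k → Fun n k → Set
f ≗ℝ g = ∀ K → f K ≈ g K

addOutside : ∀ {n k} → KSubset n k → KSubset (suc n) k
addOutside (K , eq) = outside Vec.∷ K , eq

addInside : ∀ {n k} → KSubset n k → KSubset (suc n) (suc k)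
addInside (K , eq) = inside Vec.∷ K , cong suc eq

-- Each k-element subset is listed exactly once.
kSubsets : ∀ n k → List (KSubset n k)
kSubsets zero    zero    = (Vec.[] , refl) ∷ []
kSubsets zero    (suc k) = []
kSubsets (suc n) zero    = map addOutside (kSubsets n zero)
kSubsets (suc n) (suc k) =
  map addInside (kSubsets n k) ++ map addOutside (kSubsets n (suc k))

size : ∀ {n k} → Fun n k → ℝ
size {n} {k} f = ∑ (kSubsets n k) f

basic : ∀ {n} k → Subset n → Subset n → Fun n k
basic k A B (K , _) = if does (A ⊆? K ×-dec K ⊆? B) then 1ℝ else 0ℝ

Disjoint : ∀ {n} → Subset n → Subset n → Set
Disjoint I J = Empty (I ∩ J)

paired : ∀ {n} k → Subset n → Subset n → Fun n k
paired k I J K = basic k I (∁ J) K +ℝ basic k J (∁ I) K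

pencil : ∀ {n} k → Subset n → Fun n k
pencil k T = basic k T ⊤

IsPencilCombination : ∀ {n k} → ℕ → Fun n k → Set
IsPencilCombination {n} {k} t f = Σ[ c ∈ (KSubset n t → ℝ) ]
  (f ≗ℝ λ K → ∑ (kSubsets n t) (λ T → c T *ℝ pencil k (proj₁ T) K))

IsZero : ∀ {n k} → Fun n k → Set
IsZero f = f ≗ℝ λ _ → 0ℝ

-- ⊥₋ stands for the degree −∞.
HasDegree : ∀ {n k} → Fun n k → ℕ ₋ → Set
HasDegree f ⊥₋    = IsZero f
HasDegree f [ t ] = ¬ IsZero f
                  × IsPencilCombination t f
                  × (∀ s → IsPencilCombination s f → t ℕ.≤ s)

-- Equality of the sets {i, j} and {a, b}.
SamePair : (i j a b : ℕ) → Set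
SamePair i j a b = (i ≡ a × j ≡ b) ⊎ (i ≡ b × j ≡ a)

-- i and j are the sizes of I and J.
module _ (n k t i j : ℕ) where

  open import Data.Nat using (_+_; _*_; _∸_; _≤_; _>_; _≥_)

  Alternative-i : Set
  Alternative-i = k ≡ t + 1 × ∃[ ℓ ] (ℓ ≤ t + 1 × SamePair i j (t + 1) ℓ)

  Case-i : Set
  Case-i = 2 ∣ t × n ≡ 2 * k × (SamePair i j (t + 1) 0 ⊎ Alternative-i)

  Case-ii : Set
  Case-ii = 2 ∣ t × n ≡ 2 * k × k ≡ t + 1
          × (1 ≤ i × i ≤ k ∸ 1) × (1 ≤ j × j ≤ k ∸ 1)
          × i + j > k
          × + ((2 * k ∸ i ∸ j) C (k ∸ i)) ℚ./ 1 ℚ.< + (k + 1) ℚ./ 2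

  Case-iii : Set
  Case-iii = 2 ∣ t × t ≤ k × n ≡ 2 * k + 1 × SamePair i j (t + 1) 0

  Case-iv : Set
  Case-iv = 2 ∣ t × n ≡ 2 * k × k ≡ t + 1
          × (1 ≤ i × i ≤ k ∸ 1) × (1 ≤ j × j ≤ k ∸ 1)
          × i + j ≥ k
          × + ((2 * k ∸ i ∸ j) C (k ∸ i)) ℚ./ 1 ≡ + (k + 1) ℚ./ 2

{-# OPTIONS --safe #-}

-- The degree is bounded below by test functions.  Choose m disjoint pairs of points
-- and a set R of k − m further points; the signed sum of a function over the 2^m sets
-- consisting of R and one point of each pair vanishes on t-pencils when t < m, because
-- some pair avoids T.  If every pair meets I or J in the right way, the two summands of
-- p_{I,J} contribute at most one term each: 1 and (-1)^m, the latter only if no point of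
-- I or J is left unpaired.  Hence degree t forces i + j ≤ t, or i + j = t + 1 with t even,
-- or n = 2k, k = t + 1, t even, i, j ≤ k < i + j.  In each situation
-- #p_{I,J} = C(n-i-j, k-i) + C(n-i-j, k-j) is compared with C(n-t, k-t) through the
-- unimodality of the binomial coefficients.
module Submission where

open import Algebra.Properties.Group using (x∙y⁻¹≈ε⇒x≈y)
open import Defs
open import Data.Bool using (Bool; true; false; _∧_; not; if_then_else_)
open import Data.Bool.Properties using (∧-assoc; ∧-identityʳ; ∧-zeroʳ)
open import Data.Empty using (⊥-elim)
open import Data.Fin using (zero; suc)
open import Data.Fin.Subset using (Subset; inside; outside; ∁; ⊤; ∣_∣; _⊆_)
open import Data.Fin.Subset.Properties
  using (_⊆?_; _∈?_; p⊆q⇒∣p∣≤∣q∣; p⊂q⇒∣p∣<∣q∣; ∣∁p∣≡n∸∣p∣; ∣p∣≤n; x∉p⇒x∈∁p; x∈p∩q⁺)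
import Data.Integer as ℤ
import Data.Integer.Properties as ℤ
open import Data.List using (List; []; _∷_; _++_; foldr; map)
open import Data.Nat as ℕ using (ℕ; zero; suc; s≤s; z≤n; _+_; _*_; _∸_; _<_; _≤_)
open import Data.Nat.Combinatorics
  using (_C_; nCk≡nC[n∸k]; nCn≡1; nC1≡n; nCk+nC[k+1]≡[n+1]C[k+1])
open import Data.Nat.Divisibility using (_∣_; divides)
import Data.Nat.Properties as ℕ
open import Data.Nat.Tactic.RingSolver using (solve-∀)
open import Data.Product using (∃-syntax; _×_; _,_; proj₁; proj₂)
open import Data.Rational as ℚ using (ℚ; 0ℚ; 1ℚ; ½)
import Data.Rational.Properties as ℚ
open import Data.Rational.Solver using (module +-*-Solver)
import Data.Rational.Unnormalised as ℚᵘ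
import Data.Rational.Unnormalised.Properties as ℚᵘ
open import Data.Sum using (_⊎_; inj₁; inj₂; [_,_]′)
open import Data.Vec using (Vec; []; _∷_; here; there)
open import Function using (_∘_)
open import Function.Bundles using (_⇔_; mk⇔)
open import Relation.Binary using (Tri; tri<; tri≈; tri>)
open import Relation.Binary.PropositionalEquality
open import Relation.Nullary using (¬_; does; yes; no; contradiction)
open import Relation.Nullary.Construct.Add.Infimum using ([_])
open import Relation.Nullary.Decidable using (_×-dec_; dec-true; dec-false)
open +-*-Solver using (solve; _:+_; _:-_; _:*_; :-_; _:=_)
open CauchyBounds using (0<*; 0<½; ½ε+½ε; ⊔-left; ⊔-right)

-- Parity is the obstacle. When every point of `I` and `J` is paired and m is odd, the contributions
-- 1 and -1 cancel, and the signed sum cannot see p_{I,J}. Leaving a single point unpaired repairs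
-- this at the price of one pair: taken from `I` the point lies in every K, taken from `J` in none,
-- so the second summand vanishes identically and the sum is 1 for every m. This lost pair is the
-- gap that lets degree t coexist with i + j = t + 1, or with a pairing of all of V into t + 1
-- pairs, and it is why t is even in every exceptional case. The coefficients of a pencil
-- combination are arbitrary Cauchy sequences, but its signed sum is exactly 0 at every index, while
-- that of p_{I,J} is a constant rational. Limits therefore enter only once, in comparing two
-- constants.

-- Signed sums over the cube.

⟦_⟧ : Bool → ℚ
⟦ b ⟧ = if b then 1ℚ else 0ℚ

∑ℚ : ∀ {A : Set} → List A → (A → ℚ) → ℚ
∑ℚ xs f = foldr (λ x acc → f x ℚ.+ acc) 0ℚ xs

-- The sum of g over the cube, signed by the parity of the number of falses.
alt : ∀ {m} → (Vec Bool m → ℚ) → ℚ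
alt {zero}  g = g []
alt {suc m} g = alt (λ c → g (true ∷ c)) ℚ.- alt (λ c → g (false ∷ c))

alt-cong : ∀ {m} {f g : Vec Bool m → ℚ} → (∀ c → f c ≡ g c) → alt f ≡ alt g
alt-cong {zero}  eq = eq []
alt-cong {suc m} eq =
  cong₂ ℚ._-_ (alt-cong (λ c → eq (true ∷ c))) (alt-cong (λ c → eq (false ∷ c)))

alt-0 : ∀ m → alt {m} (λ _ → 0ℚ) ≡ 0ℚ
alt-0 zero    = refl
alt-0 (suc m) = cong₂ ℚ._-_ (alt-0 m) (alt-0 m)

alt-+ : ∀ {m} (f g : Vec Bool m → ℚ) →
  alt (λ c → f c ℚ.+ g c) ≡ alt f ℚ.+ alt g
alt-+ {zero}  f g = refl
alt-+ {suc m} f g = trans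
  (cong₂ ℚ._-_ (alt-+ (λ c → f (true ∷ c)) (λ c → g (true ∷ c)))
               (alt-+ (λ c → f (false ∷ c)) (λ c → g (false ∷ c))))
  (interchange (alt (λ c → f (true ∷ c))) (alt (λ c → g (true ∷ c)))
               (alt (λ c → f (false ∷ c))) (alt (λ c → g (false ∷ c))))
  where
  interchange : ∀ a b c d → (a ℚ.+ b) ℚ.- (c ℚ.+ d) ≡ (a ℚ.- c) ℚ.+ (b ℚ.- d)
  interchange =
    solve 4 (λ a b c d → (a :+ b) :- (c :+ d) := (a :- c) :+ (b :- d)) refl

alt-* : ∀ {m} q (f : Vec Bool m → ℚ) → alt (λ c → q ℚ.* f c) ≡ q ℚ.* alt f
alt-* {zero}  q f = refl
alt-* {suc m} q f = trans
  (cong₂ ℚ._-_ (alt-* q (λ c → f (true ∷ c))) (alt-* q (λ c → f (false ∷ c))))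
  (factor q (alt (λ c → f (true ∷ c))) (alt (λ c → f (false ∷ c))))
  where
  factor : ∀ q a b → q ℚ.* a ℚ.- q ℚ.* b ≡ q ℚ.* (a ℚ.- b)
  factor = solve 3 (λ q a b → (q :* a) :- (q :* b) := q :* (a :- b)) refl

alt-∑ : ∀ {m} {A : Set} (xs : List A) (q : A → ℚ) (g : A → Vec Bool m → ℚ) →
  (∀ x → alt (g x) ≡ 0ℚ) → alt (λ c → ∑ℚ xs (λ x → q x ℚ.* g x c)) ≡ 0ℚ
alt-∑ {m} []       q g g≡0 = alt-0 m
alt-∑ {m} (x ∷ xs) q g g≡0 = begin
  alt (λ c → q x ℚ.* g x c ℚ.+ ∑ℚ xs (λ x → q x ℚ.* g x c))
    ≡⟨ alt-+ (λ c → q x ℚ.* g x c) _ ⟩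
  alt (λ c → q x ℚ.* g x c) ℚ.+ alt (λ c → ∑ℚ xs (λ x → q x ℚ.* g x c))
    ≡⟨ cong₂ ℚ._+_ (alt-* (q x) (g x)) (alt-∑ xs q g g≡0) ⟩
  q x ℚ.* alt (g x) ℚ.+ 0ℚ
    ≡⟨ ℚ.+-identityʳ _ ⟩
  q x ℚ.* alt (g x)
    ≡⟨ cong (q x ℚ.*_) (g≡0 x) ⟩
  q x ℚ.* 0ℚ
    ≡⟨ ℚ.*-zeroʳ (q x) ⟩
  0ℚ ∎
  where open ≡-Reasoning

full : ∀ {m} → Vec Bool m → Bool
full []      = true
full (b ∷ c) = b ∧ full c

void : ∀ {m} → Vec Bool m → Bool
void []      = true
void (b ∷ c) = not b ∧ void c

sign : ℕ → ℚ
sign zero    = 1ℚ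
sign (suc m) = ℚ.- sign m

alt-full : ∀ m → alt {m} (λ c → ⟦ full c ⟧) ≡ 1ℚ
alt-full zero    = refl
alt-full (suc m) = cong₂ ℚ._-_ (alt-full m) (alt-0 m)

alt-void : ∀ m → alt {m} (λ c → ⟦ void c ⟧) ≡ sign m
alt-void zero    = refl
alt-void (suc m) = trans (cong₂ ℚ._-_ (alt-0 m) (alt-void m)) (ℚ.+-identityˡ _)

-- Subsets as triples of blocks on I, J and the rest W.

-- i and j count the points of I and of J, and w those outside both.
data Split : ∀ {n} → Subset n → Subset n → ℕ → ℕ → ℕ → Set where
  []  : Split [] [] 0 0 0
  inI : ∀ {n i j w} {I J : Subset n} → Split I J i j w →
    Split (inside ∷ I) (outside ∷ J) (suc i) j w
  inJ : ∀ {n i j w} {I J : Subset n} → Split I J i j w →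
    Split (outside ∷ I) (inside ∷ J) i (suc j) w
  inW : ∀ {n i j w} {I J : Subset n} → Split I J i j w →
    Split (outside ∷ I) (outside ∷ J) i j (suc w)

split : ∀ {n} (I J : Subset n) → Disjoint I J → ∃[ w ] Split I J ∣ I ∣ ∣ J ∣ w
split []            []            dis = 0 , []
split (inside ∷ I)  (inside ∷ J)  dis = ⊥-elim (dis (zero , here))
split (inside ∷ I)  (outside ∷ J) dis with split I J (λ (x , p) → dis (suc x , there p))
... | w , σ = w , inI σ
split (outside ∷ I) (inside ∷ J)  dis with split I J (λ (x , p) → dis (suc x , there p))
... | w , σ = w , inJ σ
split (outside ∷ I) (outside ∷ J) dis with split I J (λ (x , p) → dis (suc x , there p))
... | w , σ = suc w , inW σ

split-swap : ∀ {n i j w} {I J : Subset n} → Split I J i j w → Split J I j i w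
split-swap []      = []
split-swap (inI σ) = inJ (split-swap σ)
split-swap (inJ σ) = inI (split-swap σ)
split-swap (inW σ) = inW (split-swap σ)

split-sum : ∀ {n i j w} {I J : Subset n} → Split I J i j w → i + j + w ≡ n
split-sum []      = refl
split-sum (inI σ) = cong suc (split-sum σ)
split-sum {i = i} {suc j} {w} (inJ σ) =
  trans (cong (_+ w) (ℕ.+-suc i j)) (cong suc (split-sum σ))
split-sum {i = i} {j} {suc w} (inW σ) = trans (ℕ.+-suc (i + j) w) (cong suc (split-sum σ))

-- With one bit vector per block, inclusions and cardinalities are computed blockwise, and patterns
-- need no indices into V.
merge : ∀ {n i j w} {I J : Subset n} → Split I J i j w →
  Vec Bool i → Vec Bool j → Vec Bool w → Subset n
merge []      x       y       z       = []
merge (inI σ) (b ∷ x) y       z       = b ∷ merge σ x y z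
merge (inJ σ) x       (b ∷ y) z       = b ∷ merge σ x y z
merge (inW σ) x       y       (b ∷ z) = b ∷ merge σ x y z

merge-surjective : ∀ {n i j w} {I J : Subset n} (σ : Split I J i j w) (T : Subset n) →
  ∃[ x ] ∃[ y ] ∃[ z ] T ≡ merge σ x y z
merge-surjective []      []      = [] , [] , [] , refl
merge-surjective (inI σ) (b ∷ T) with merge-surjective σ T
... | x , y , z , refl = b ∷ x , y , z , refl
merge-surjective (inJ σ) (b ∷ T) with merge-surjective σ T
... | x , y , z , refl = x , b ∷ y , z , refl
merge-surjective (inW σ) (b ∷ T) with merge-surjective σ T
... | x , y , z , refl = x , y , b ∷ z , refl

∣merge∣ : ∀ {n i j w} {I J : Subset n} (σ : Split I J i j w) x y z →
  ∣ merge σ x y z ∣ ≡ ∣ x ∣ + ∣ y ∣ + ∣ z ∣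
∣merge∣ []      []           []           []           = refl
∣merge∣ (inI σ) (true  ∷ x)  y            z            = cong suc (∣merge∣ σ x y z)
∣merge∣ (inI σ) (false ∷ x)  y            z            = ∣merge∣ σ x y z
∣merge∣ (inJ σ) x            (true  ∷ y)  z            =
  trans (cong suc (∣merge∣ σ x y z)) (cong (_+ ∣ z ∣) (sym (ℕ.+-suc ∣ x ∣ ∣ y ∣)))
∣merge∣ (inJ σ) x            (false ∷ y)  z            = ∣merge∣ σ x y z
∣merge∣ (inW σ) x            y            (true  ∷ z)  =
  trans (cong suc (∣merge∣ σ x y z)) (sym (ℕ.+-suc (∣ x ∣ + ∣ y ∣) ∣ z ∣))
∣merge∣ (inW σ) x            y            (false ∷ z)  = ∣merge∣ σ x y z

infix 4 _⊆ᵇ_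
_⊆ᵇ_ : ∀ {n} → Subset n → Subset n → Bool
p ⊆ᵇ q = does (p ⊆? q)

∷-⊆ᵇ-∷ : ∀ {n} a b (p q : Subset n) → (a ∷ p ⊆ᵇ b ∷ q) ≡ (a ∷ [] ⊆ᵇ b ∷ []) ∧ (p ⊆ᵇ q)
∷-⊆ᵇ-∷ true  true  p q = refl
∷-⊆ᵇ-∷ true  false p q = refl
∷-⊆ᵇ-∷ false b     p q = refl

⊆ᵇ-⊤ : ∀ {n} (p : Subset n) → (p ⊆ᵇ ⊤) ≡ true
⊆ᵇ-⊤ []          = refl
⊆ᵇ-⊤ (true  ∷ p) = ⊆ᵇ-⊤ p
⊆ᵇ-⊤ (false ∷ p) = ⊆ᵇ-⊤ p

merge-⊆ᵇ-merge : ∀ {n i j w} {I J : Subset n} (σ : Split I J i j w) x y z x′ y′ z′ →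
  (merge σ x y z ⊆ᵇ merge σ x′ y′ z′) ≡ (x ⊆ᵇ x′) ∧ ((y ⊆ᵇ y′) ∧ (z ⊆ᵇ z′))
merge-⊆ᵇ-merge [] [] [] [] [] [] [] = refl
merge-⊆ᵇ-merge (inI σ) (a ∷ x) y z (a′ ∷ x′) y′ z′
  rewrite ∷-⊆ᵇ-∷ a a′ (merge σ x y z) (merge σ x′ y′ z′) | ∷-⊆ᵇ-∷ a a′ x x′
        | merge-⊆ᵇ-merge σ x y z x′ y′ z′ = sym (∧-assoc (a ∷ [] ⊆ᵇ a′ ∷ []) _ _)
merge-⊆ᵇ-merge (inJ σ) x (a ∷ y) z x′ (a′ ∷ y′) z′
  rewrite ∷-⊆ᵇ-∷ a a′ (merge σ x y z) (merge σ x′ y′ z′) | ∷-⊆ᵇ-∷ a a′ y y′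
        | merge-⊆ᵇ-merge σ x y z x′ y′ z′
  with a ∷ [] ⊆ᵇ a′ ∷ []
... | true  = refl
... | false = sym (∧-zeroʳ (x ⊆ᵇ x′))
merge-⊆ᵇ-merge (inW σ) x y (a ∷ z) x′ y′ (a′ ∷ z′)
  rewrite ∷-⊆ᵇ-∷ a a′ (merge σ x y z) (merge σ x′ y′ z′) | ∷-⊆ᵇ-∷ a a′ z z′
        | merge-⊆ᵇ-merge σ x y z x′ y′ z′
  with a ∷ [] ⊆ᵇ a′ ∷ []
... | true  = refl
... | false = sym (trans (cong ((x ⊆ᵇ x′) ∧_) (∧-zeroʳ (y ⊆ᵇ y′))) (∧-zeroʳ (x ⊆ᵇ x′)))

I⊆ᵇmerge : ∀ {n i j w} {I J : Subset n} (σ : Split I J i j w) x y z →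
  (I ⊆ᵇ merge σ x y z) ≡ full x
I⊆ᵇmerge []      []          []      []      = refl
I⊆ᵇmerge (inI σ) (true ∷ x)  y       z       = I⊆ᵇmerge σ x y z
I⊆ᵇmerge (inI σ) (false ∷ x) y       z       = refl
I⊆ᵇmerge (inJ σ) x           (b ∷ y) z       = I⊆ᵇmerge σ x y z
I⊆ᵇmerge (inW σ) x           y       (b ∷ z) = I⊆ᵇmerge σ x y z

merge⊆ᵇ∁J : ∀ {n i j w} {I J : Subset n} (σ : Split I J i j w) x y z →
  (merge σ x y z ⊆ᵇ ∁ J) ≡ void y
merge⊆ᵇ∁J []      []          []          []          = refl
merge⊆ᵇ∁J (inI σ) (true ∷ x)  y           z           = merge⊆ᵇ∁J σ x y z
merge⊆ᵇ∁J (inI σ) (false ∷ x) y           z           = merge⊆ᵇ∁J σ x y z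
merge⊆ᵇ∁J (inJ σ) x           (true ∷ y)  z           = refl
merge⊆ᵇ∁J (inJ σ) x           (false ∷ y) z           = merge⊆ᵇ∁J σ x y z
merge⊆ᵇ∁J (inW σ) x           y           (true ∷ z)  = merge⊆ᵇ∁J σ x y z
merge⊆ᵇ∁J (inW σ) x           y           (false ∷ z) = merge⊆ᵇ∁J σ x y z

merge-swap : ∀ {n i j w} {I J : Subset n} (σ : Split I J i j w) x y z →
  merge (split-swap σ) y x z ≡ merge σ x y z
merge-swap []      []      []      []      = refl
merge-swap (inI σ) (b ∷ x) y       z       = cong (b ∷_) (merge-swap σ x y z)
merge-swap (inJ σ) x       (b ∷ y) z       = cong (b ∷_) (merge-swap σ x y z)
merge-swap (inW σ) x       y       (b ∷ z) = cong (b ∷_) (merge-swap σ x y z)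

J⊆ᵇmerge : ∀ {n i j w} {I J : Subset n} (σ : Split I J i j w) x y z →
  (J ⊆ᵇ merge σ x y z) ≡ full y
J⊆ᵇmerge {J = J} σ x y z = trans
  (cong (J ⊆ᵇ_) (sym (merge-swap σ x y z))) (I⊆ᵇmerge (split-swap σ) y x z)

merge⊆ᵇ∁I : ∀ {n i j w} {I J : Subset n} (σ : Split I J i j w) x y z →
  (merge σ x y z ⊆ᵇ ∁ I) ≡ void x
merge⊆ᵇ∁I {I = I} σ x y z = trans
  (cong (_⊆ᵇ ∁ I) (sym (merge-swap σ x y z))) (merge⊆ᵇ∁J (split-swap σ) y x z)

-- Pairings of points and their test functions.

-- A pattern with m pairs turns a vertex c of the m-cube into a k-set K taking one
-- point of each pair: true stands for the point of I, or else for the one outside J.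
-- Thus I ⊆ K and J ∩ K = ∅ exactly at the all-true vertex.  The d unpaired points of
-- I and J are fixed so as to be compatible with this.
data Pattern : (m d i j w k : ℕ) → Set where
  []   : Pattern 0 0 0 0 0 0
  I-J  : ∀ {m d i j w k} → Pattern m d i j w k → Pattern (suc m) d (suc i) (suc j) w (suc k)
  I-W  : ∀ {m d i j w k} → Pattern m d i j w k → Pattern (suc m) d (suc i) j (suc w) (suc k)
  J-W  : ∀ {m d i j w k} → Pattern m d i j w k → Pattern (suc m) d i (suc j) (suc w) (suc k)
  I-in  : ∀ {m d i j w k} → Pattern m d i j w k → Pattern m (suc d) (suc i) j w (suc k)
  J-out : ∀ {m d i j w k} → Pattern m d i j w k → Pattern m (suc d) i (suc j) w k
  W-in  : ∀ {m d i j w k} → Pattern m d i j w k → Pattern m d i j (suc w) (suc k)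
  W-out : ∀ {m d i j w k} → Pattern m d i j w k → Pattern m d i j (suc w) k

onI : ∀ {m d i j w k} → Pattern m d i j w k → Vec Bool m → Vec Bool i
onI []        c       = []
onI (I-J π)   (b ∷ c) = b ∷ onI π c
onI (I-W π)   (b ∷ c) = b ∷ onI π c
onI (J-W π)   (b ∷ c) = onI π c
onI (I-in π)  c       = true ∷ onI π c
onI (J-out π) c       = onI π c
onI (W-in π)  c       = onI π c
onI (W-out π) c       = onI π c

onJ : ∀ {m d i j w k} → Pattern m d i j w k → Vec Bool m → Vec Bool j
onJ []        c       = []
onJ (I-J π)   (b ∷ c) = not b ∷ onJ π c
onJ (I-W π)   (b ∷ c) = onJ π c
onJ (J-W π)   (b ∷ c) = not b ∷ onJ π c
onJ (I-in π)  c       = onJ π c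
onJ (J-out π) c       = false ∷ onJ π c
onJ (W-in π)  c       = onJ π c
onJ (W-out π) c       = onJ π c

onW : ∀ {m d i j w k} → Pattern m d i j w k → Vec Bool m → Vec Bool w
onW []        c       = []
onW (I-J π)   (b ∷ c) = onW π c
onW (I-W π)   (b ∷ c) = not b ∷ onW π c
onW (J-W π)   (b ∷ c) = b ∷ onW π c
onW (I-in π)  c       = onW π c
onW (J-out π) c       = onW π c
onW (W-in π)  c       = true ∷ onW π c
onW (W-out π) c       = false ∷ onW π c

+-suc-mid : ∀ x y z → x + suc y + z ≡ suc (x + y + z)
+-suc-mid = solve-∀

+-suc-last : ∀ x y z → x + y + suc z ≡ suc (x + y + z)
+-suc-last = solve-∀

∣pattern∣ : ∀ {m d i j w k} (π : Pattern m d i j w k) c →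
  ∣ onI π c ∣ + ∣ onJ π c ∣ + ∣ onW π c ∣ ≡ k
∣pattern∣ []        []          = refl
∣pattern∣ (I-J π)   (true  ∷ c) = cong suc (∣pattern∣ π c)
∣pattern∣ (I-J π)   (false ∷ c) =
  trans (+-suc-mid (∣ onI π c ∣) (∣ onJ π c ∣) (∣ onW π c ∣)) (cong suc (∣pattern∣ π c))
∣pattern∣ (I-W π)   (true  ∷ c) = cong suc (∣pattern∣ π c)
∣pattern∣ (I-W π)   (false ∷ c) =
  trans (+-suc-last (∣ onI π c ∣) (∣ onJ π c ∣) (∣ onW π c ∣)) (cong suc (∣pattern∣ π c))
∣pattern∣ (J-W π)   (true  ∷ c) =
  trans (+-suc-last (∣ onI π c ∣) (∣ onJ π c ∣) (∣ onW π c ∣)) (cong suc (∣pattern∣ π c))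
∣pattern∣ (J-W π)   (false ∷ c) =
  trans (+-suc-mid (∣ onI π c ∣) (∣ onJ π c ∣) (∣ onW π c ∣)) (cong suc (∣pattern∣ π c))
∣pattern∣ (I-in π)  c           = cong suc (∣pattern∣ π c)
∣pattern∣ (J-out π) c           = ∣pattern∣ π c
∣pattern∣ (W-in π)  c           =
  trans (+-suc-last (∣ onI π c ∣) (∣ onJ π c ∣) (∣ onW π c ∣)) (cong suc (∣pattern∣ π c))
∣pattern∣ (W-out π) c           = ∣pattern∣ π c

full-void : ∀ {m d i j w k} (π : Pattern m d i j w k) c →
  full (onI π c) ∧ void (onJ π c) ≡ full c
full-void []        []          = refl
full-void (I-J π)   (true  ∷ c) = full-void π c
full-void (I-J π)   (false ∷ c) = refl
full-void (I-W π)   (true  ∷ c) = full-void π c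
full-void (I-W π)   (false ∷ c) = refl
full-void (J-W π)   (true  ∷ c) = full-void π c
full-void (J-W π)   (false ∷ c) = ∧-zeroʳ _
full-void (I-in π)  c           = full-void π c
full-void (J-out π) c           = full-void π c
full-void (W-in π)  c           = full-void π c
full-void (W-out π) c           = full-void π c

isZero : ℕ → Bool
isZero zero    = true
isZero (suc _) = false

-- The other summand lives at the all-false vertex, and only if nothing is unpaired: an `I-in` point
-- violates K ⊆ ∁ I, a `J-out` point violates J ⊆ K.
void-full : ∀ {m d i j w k} (π : Pattern m d i j w k) c →
  full (onJ π c) ∧ void (onI π c) ≡ isZero d ∧ void c
void-full []        []          = refl
void-full {d = d} (I-J π) (true ∷ c) = sym (∧-zeroʳ (isZero d))
void-full (I-J π)   (false ∷ c) = void-full π c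
void-full {d = d} (I-W π) (true ∷ c) = trans (∧-zeroʳ _) (sym (∧-zeroʳ (isZero d)))
void-full (I-W π)   (false ∷ c) = void-full π c
void-full {d = d} (J-W π) (true ∷ c) = sym (∧-zeroʳ (isZero d))
void-full (J-W π)   (false ∷ c) = void-full π c
void-full (I-in π)  c           = ∧-zeroʳ _
void-full (J-out π) c           = refl
void-full (W-in π)  c           = void-full π c
void-full (W-out π) c           = void-full π c

alt-≡0 : ∀ {m} {g : Vec Bool m → ℚ} → (∀ c → g c ≡ 0ℚ) → alt g ≡ 0ℚ
alt-≡0 {m} g≡0 = trans (alt-cong g≡0) (alt-0 m)

∧-zero-last : ∀ a b → a ∧ (b ∧ false) ≡ false
∧-zero-last a b = trans (cong (a ∧_) (∧-zeroʳ b)) (∧-zeroʳ a)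

drop-mid : ∀ x y {z m} → x + suc y + z < suc m → x + y + z < m
drop-mid x y {z} {m} p = ℕ.s≤s⁻¹ (subst (_< suc m) (+-suc-mid x y z) p)

drop-last : ∀ x y {z m} → x + y + suc z < suc m → x + y + z < m
drop-last x y {z} {m} p = ℕ.s≤s⁻¹ (subst (_< suc m) (+-suc-last x y z) p)

-- The value at vertex c of the pencil of T, where T has the blocks x, y, z.
within : ∀ {m d i j w k} → Pattern m d i j w k →
  Vec Bool i → Vec Bool j → Vec Bool w → Vec Bool m → ℚ
within π x y z c = ⟦ (x ⊆ᵇ onI π c) ∧ ((y ⊆ᵇ onJ π c) ∧ (z ⊆ᵇ onW π c)) ⟧

-- Induction on the pattern. A pair missed by T makes the two halves of the sum equal, so they
-- cancel. If T contains one point of the pair, one half is 0 and the other is the same problem with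
-- one pair and one point of T fewer; if T contains both, both halves are 0. Unpaired points can
-- only shrink T or kill the sum. Strictness excludes running out of pairs first.
alt-vanish : ∀ {m d i j w k} (π : Pattern m d i j w k) x y z →
  ∣ x ∣ + ∣ y ∣ + ∣ z ∣ < m →
  alt (within π x y z) ≡ 0ℚ
alt-vanish [] x y z ()
alt-vanish {suc m} (I-J π) (true ∷ x) (true ∷ y) z (s≤s p) = cong₂ ℚ._-_
  (alt-≡0 (λ c → cong ⟦_⟧ (∧-zeroʳ (x ⊆ᵇ onI π c))))
  (alt-0 m)
alt-vanish {suc m} (I-J π) (true ∷ x) (false ∷ y) z (s≤s p) = cong₂ ℚ._-_
  (alt-vanish π x y z p) (alt-0 m)
alt-vanish {suc m} (I-J π) (false ∷ x) (true ∷ y) z p = cong₂ ℚ._-_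
  (alt-≡0 (λ c → cong ⟦_⟧ (∧-zeroʳ (x ⊆ᵇ onI π c))))
  (alt-vanish π x y z (drop-mid (∣ x ∣) (∣ y ∣) p))
alt-vanish {suc m} (I-J π) (false ∷ x) (false ∷ y) z p = ℚ.+-inverseʳ (alt (within π x y z))
alt-vanish {suc m} (I-W π) (true ∷ x) y (true ∷ z) (s≤s p) = cong₂ ℚ._-_
  (alt-≡0 (λ c → cong ⟦_⟧ (∧-zero-last (x ⊆ᵇ onI π c) (y ⊆ᵇ onJ π c))))
  (alt-0 m)
alt-vanish {suc m} (I-W π) (true ∷ x) y (false ∷ z) (s≤s p) = cong₂ ℚ._-_
  (alt-vanish π x y z p) (alt-0 m)
alt-vanish {suc m} (I-W π) (false ∷ x) y (true ∷ z) p = cong₂ ℚ._-_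
  (alt-≡0 (λ c → cong ⟦_⟧ (∧-zero-last (x ⊆ᵇ onI π c) (y ⊆ᵇ onJ π c))))
  (alt-vanish π x y z (drop-last (∣ x ∣) (∣ y ∣) p))
alt-vanish {suc m} (I-W π) (false ∷ x) y (false ∷ z) p = ℚ.+-inverseʳ (alt (within π x y z))
alt-vanish (J-W π) x (true ∷ y) (true ∷ z) p = cong₂ ℚ._-_
  (alt-≡0 (λ c → cong ⟦_⟧ (∧-zeroʳ (x ⊆ᵇ onI π c))))
  (alt-≡0 (λ c → cong ⟦_⟧ (∧-zero-last (x ⊆ᵇ onI π c) (y ⊆ᵇ onJ π c))))
alt-vanish (J-W π) x (true ∷ y) (false ∷ z) p = cong₂ ℚ._-_
  (alt-≡0 (λ c → cong ⟦_⟧ (∧-zeroʳ (x ⊆ᵇ onI π c))))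
  (alt-vanish π x y z (drop-mid (∣ x ∣) (∣ y ∣) p))
alt-vanish (J-W π) x (false ∷ y) (true ∷ z) p = cong₂ ℚ._-_
  (alt-vanish π x y z (drop-last (∣ x ∣) (∣ y ∣) p))
  (alt-≡0 (λ c → cong ⟦_⟧ (∧-zero-last (x ⊆ᵇ onI π c) (y ⊆ᵇ onJ π c))))
alt-vanish (J-W π) x (false ∷ y) (false ∷ z) p = ℚ.+-inverseʳ (alt (within π x y z))
alt-vanish (I-in π) (true ∷ x) y z p = alt-vanish π x y z (ℕ.<-trans (ℕ.n<1+n _) p)
alt-vanish (I-in π) (false ∷ x) y z p = alt-vanish π x y z p
alt-vanish (J-out π) x (true ∷ y) z p =
  alt-≡0 (λ c → cong ⟦_⟧ (∧-zeroʳ (x ⊆ᵇ onI π c)))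
alt-vanish (J-out π) x (false ∷ y) z p = alt-vanish π x y z p
alt-vanish (W-in π) x y (true ∷ z) p = alt-vanish π x y z
  (drop-last (∣ x ∣) (∣ y ∣) (ℕ.m<n⇒m<1+n p))
alt-vanish (W-in π) x y (false ∷ z) p = alt-vanish π x y z p
alt-vanish (W-out π) x y (true ∷ z) p =
  alt-≡0 (λ c → cong ⟦_⟧ (∧-zero-last (x ⊆ᵇ onI π c) (y ⊆ᵇ onJ π c)))
alt-vanish (W-out π) x y (false ∷ z) p = alt-vanish π x y z p

-- Lower bounds on the degree from test functions.

seq-∑ : ∀ {A : Set} (xs : List A) (f : A → ℝ) n → seq (∑ xs f) n ≡ ∑ℚ xs (λ x → seq (f x) n)
seq-∑ []       f n = refl
seq-∑ (x ∷ xs) f n = cong (seq (f x) n ℚ.+_) (seq-∑ xs f n)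

dist-- : ∀ a b c d → dist (a ℚ.- b) (c ℚ.- d) ℚ.≤ dist a c ℚ.+ dist b d
dist-- a b c d = subst₂ ℚ._≤_
  (cong ℚ.∣_∣ (eq a b c d)) refl (ℚ.∣p-q∣≤∣p∣+∣q∣ (a ℚ.- c) (b ℚ.- d))
  where
  eq : ∀ a b c d → (a ℚ.- c) ℚ.- (b ℚ.- d) ≡ (a ℚ.- b) ℚ.- (c ℚ.- d)
  eq = solve 4 (λ a b c d → (a :- c) :- (b :- d) := (a :- b) :- (c :- d)) refl

-- Each vertex comes with its own index of closeness; halving the tolerance at every coordinate
-- produces one index for the whole cube.
alt-≈ : ∀ {m} (f g : Vec Bool m → ℝ) → (∀ c → f c ≈ g c) → ∀ ε → 0ℚ ℚ.< ε →
  ∃[ N ] (∀ n → N ≤ n → dist (alt (λ c → seq (f c) n)) (alt (λ c → seq (g c) n)) ℚ.< ε)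
alt-≈ {zero}  f g f≈g ε 0<ε = f≈g [] ε 0<ε
alt-≈ {suc m} f g f≈g ε 0<ε =
  let M , p = alt-≈ (λ c → f (true ∷ c)) (λ c → g (true ∷ c)) (λ c → f≈g (true ∷ c)) (ε ℚ.* ½) (0<* 0<ε 0<½)
      N , q = alt-≈ (λ c → f (false ∷ c)) (λ c → g (false ∷ c)) (λ c → f≈g (false ∷ c)) (ε ℚ.* ½) (0<* 0<ε 0<½)
  in M ℕ.⊔ N , λ n M⊔N≤n → ℚ.≤-<-trans
    (dist-- (alt (λ c → seq (f (true ∷ c)) n)) (alt (λ c → seq (f (false ∷ c)) n))
            (alt (λ c → seq (g (true ∷ c)) n)) (alt (λ c → seq (g (false ∷ c)) n)))
    (subst (_ ℚ.<_) (½ε+½ε ε)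
      (ℚ.+-mono-< (p n (⊔-left M N M⊔N≤n)) (q n (⊔-right M N M⊔N≤n))))

-- With q itself as the tolerance, the constants q and 0 would have to be closer than q.
alt-≈-0 : ∀ {m} (f g : Vec Bool m → ℝ) → (∀ c → f c ≈ g c) → ∀ q → 0ℚ ℚ.< q →
  (∀ N → alt (λ c → seq (f c) N) ≡ q) → ¬ (∀ N → alt (λ c → seq (g c) N) ≡ 0ℚ)
alt-≈-0 f g f≈g q 0<q f≡q g≡0 with alt-≈ f g f≈g q 0<q
... | N , close = ℚ.<-irrefl (trans (cong ℚ.∣_∣ (ℚ.+-identityʳ q)) (ℚ.0≤p⇒∣p∣≡p (ℚ.<⇒≤ 0<q)))
  (subst₂ (λ u v → dist u v ℚ.< q) (f≡q N) (g≡0 N) (close N ℕ.≤-refl))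

-- Abstract, so that unification never unfolds the real-valued identity.
abstract
  Deg≤ : ∀ {n} (k t : ℕ) (I J : Subset n) → Set
  Deg≤ k t I J = IsPencilCombination t (paired k I J)

  deg≤⁺ : ∀ {n k t} {I J : Subset n} → IsPencilCombination t (paired k I J) → Deg≤ k t I J
  deg≤⁺ comb = comb

  deg≤⁻ : ∀ {n k t} {I J : Subset n} → Deg≤ k t I J → IsPencilCombination t (paired k I J)
  deg≤⁻ comb = comb

module _ {n k m d i j w t : ℕ} {I J : Subset n}
  (σ : Split I J i j w) (π : Pattern m d i j w k) where

  transversal : Vec Bool m → KSubset n k
  transversal c = merge σ (onI π c) (onJ π c) (onW π c)
    , trans (∣merge∣ σ (onI π c) (onJ π c) (onW π c)) (∣pattern∣ π c)

  seq-paired : ∀ c N →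
    seq (paired k I J (transversal c)) N ≡ ⟦ full c ⟧ ℚ.+ ⟦ isZero d ∧ void c ⟧
  seq-paired c N
    rewrite I⊆ᵇmerge σ (onI π c) (onJ π c) (onW π c)
          | merge⊆ᵇ∁J σ (onI π c) (onJ π c) (onW π c)
          | J⊆ᵇmerge σ (onI π c) (onJ π c) (onW π c)
          | merge⊆ᵇ∁I σ (onI π c) (onJ π c) (onW π c)
          | full-void π c | void-full π c
    with full c | isZero d ∧ void c
  ... | true  | true  = refl
  ... | true  | false = refl
  ... | false | true  = refl
  ... | false | false = refl

  seq-pencil : ∀ (T : KSubset n t) x y z → proj₁ T ≡ merge σ x y z → ∀ c N →
    seq (pencil k (proj₁ T) (transversal c)) N
      ≡ within π x y z c
  seq-pencil T x y z refl c N
    rewrite merge-⊆ᵇ-merge σ x y z (onI π c) (onJ π c) (onW π c)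
          | ⊆ᵇ-⊤ (merge σ (onI π c) (onJ π c) (onW π c))
    with (x ⊆ᵇ onI π c) ∧ ((y ⊆ᵇ onJ π c) ∧ (z ⊆ᵇ onW π c))
  ... | true  = refl
  ... | false = refl

  alt-pencil : t < m → ∀ (T : KSubset n t) N →
    alt (λ c → seq (pencil k (proj₁ T) (transversal c)) N) ≡ 0ℚ
  alt-pencil t<m T@(T′ , ∣T∣≡t) N with merge-surjective σ T′
  ... | x , y , z , eq = trans (alt-cong (λ c → seq-pencil T x y z eq c N))
    (alt-vanish π x y z
      (subst (_< m) (trans (sym ∣T∣≡t) (trans (cong ∣_∣ eq) (∣merge∣ σ x y z))) t<m))

  alt-paired : ∀ N → alt (λ c → seq (paired k I J (transversal c)) N)
    ≡ 1ℚ ℚ.+ alt {m} (λ c → ⟦ isZero d ∧ void c ⟧)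
  alt-paired N = begin
    alt (λ c → seq (paired k I J (transversal c)) N)
      ≡⟨ alt-cong (λ c → seq-paired c N) ⟩
    alt {m} (λ c → ⟦ full c ⟧ ℚ.+ ⟦ isZero d ∧ void c ⟧)
      ≡⟨ alt-+ {m} (λ c → ⟦ full c ⟧) (λ c → ⟦ isZero d ∧ void c ⟧) ⟩
    alt {m} (λ c → ⟦ full c ⟧) ℚ.+ alt {m} (λ c → ⟦ isZero d ∧ void c ⟧)
      ≡⟨ cong (ℚ._+ alt {m} (λ c → ⟦ isZero d ∧ void c ⟧)) (alt-full m) ⟩
    1ℚ ℚ.+ alt {m} (λ c → ⟦ isZero d ∧ void c ⟧) ∎
    where open ≡-Reasoning

  alt-combination : t < m → ∀ (a : KSubset n t → ℝ) N →
    alt (λ c → seq (∑ (kSubsets n t) (λ T → a T *ℝ pencil k (proj₁ T) (transversal c))) N) ≡ 0ℚ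
  alt-combination t<m a N = trans
    (alt-cong (λ c → seq-∑ (kSubsets n t) (λ T → a T *ℝ pencil k (proj₁ T) (transversal c)) N))
    (alt-∑ (kSubsets n t) (λ T → seq (a T) N)
      (λ T c → seq (pencil k (proj₁ T) (transversal c)) N) (λ T → alt-pencil t<m T N))

  combination-degree : 0ℚ ℚ.< 1ℚ ℚ.+ alt {m} (λ c → ⟦ isZero d ∧ void c ⟧) →
    IsPencilCombination t (paired k I J) → m ≤ t
  combination-degree 0<q (a , p≈) = ℕ.≮⇒≥ λ t<m →
    alt-≈-0 (λ c → paired k I J (transversal c))
      (λ c → ∑ (kSubsets n t) (λ T → a T *ℝ pencil k (proj₁ T) (transversal c)))
      (λ c → p≈ (transversal c)) _ 0<q alt-paired (alt-combination t<m a)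

  deg≤-bound : 0ℚ ℚ.< 1ℚ ℚ.+ alt {m} (λ c → ⟦ isZero d ∧ void c ⟧) → Deg≤ k t I J → m ≤ t
  deg≤-bound 0<q deg = combination-degree 0<q (deg≤⁻ {n} {k} {t} {I} {J} deg)

-- `suc d` records an unpaired point, so the second summand drops out and the signed sum is 1 for
-- either parity of m.
degree≥-loose : ∀ {n k m d i j w t} {I J : Subset n} → Split I J i j w →
  Pattern m (suc d) i j w k → Deg≤ k t I J → m ≤ t
degree≥-loose {m = m} σ π = deg≤-bound σ π
  (subst (λ q → 0ℚ ℚ.< 1ℚ ℚ.+ q) (sym (alt-0 m)) (ℚ.positive⁻¹ 1ℚ))

sign-even : ∀ h → sign (2 ℕ.* h) ≡ 1ℚ
sign-even zero    = refl
sign-even (suc h) = trans (cong (λ m → sign (suc m)) (ℕ.+-suc h (h + 0)))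
  (trans (neg-involutive (sign (2 ℕ.* h))) (sign-even h))
  where
  neg-involutive : ∀ q → ℚ.- (ℚ.- q) ≡ q
  neg-involutive = solve 1 (λ q → :- (:- q) := q) refl

-- With everything paired the signed sum is 1 + (-1)^m; evenness makes it 2 instead of 0.
degree≥-tight : ∀ {n k m i j w t} {I J : Subset n} → Split I J i j w →
  Pattern m 0 i j w k → 2 ∣ m → Deg≤ k t I J → m ≤ t
degree≥-tight {m = m} σ π (divides h refl) = deg≤-bound σ π
  (subst (λ q → 0ℚ ℚ.< 1ℚ ℚ.+ q)
    (sym (trans (alt-void m) (trans (cong sign (ℕ.*-comm h 2)) (sign-even h))))
    (ℚ.positive⁻¹ (1ℚ ℚ.+ 1ℚ)))

-- `u`, `a`, `b` count the pairs I-J, I-W, J-W; `p` and `q` the unpaired points of I and of J; `r`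
-- and `o` the points of W fixed inside and outside K.
pattern-of : ∀ u a b p q r o →
  Pattern (u + (a + b)) (p + q) (u + (a + p)) (u + (b + q))
    (a + (b + (r + o))) (u + (a + (b + (p + r))))
pattern-of (suc u) a b p q r o = I-J (pattern-of u a b p q r o)
pattern-of zero (suc a) b p q r o = I-W (pattern-of 0 a b p q r o)
pattern-of zero zero (suc b) p q r o = J-W (pattern-of 0 0 b p q r o)
pattern-of zero zero zero (suc p) q r o = I-in (pattern-of 0 0 0 p q r o)
pattern-of zero zero zero zero (suc q) r o = J-out (pattern-of 0 0 0 0 q r o)
pattern-of zero zero zero zero zero (suc r) o = W-in (pattern-of 0 0 0 0 0 r o)
pattern-of zero zero zero zero zero zero (suc o) = W-out (pattern-of 0 0 0 0 0 0 o)
pattern-of zero zero zero zero zero zero zero = []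

-- Counting the k-sets between I and the complement of J.

-- w C (k − i), read as 0 when k < i.
extensions : ℕ → ℕ → ℕ → ℕ
extensions w k       zero    = w C k
extensions w zero    (suc i) = 0
extensions w (suc k) (suc i) = extensions w k i

nC0≡1 : ∀ n → n C 0 ≡ 1
nC0≡1 n = trans (nCk≡nC[n∸k] {0} {n} z≤n) (nCn≡1 n)

extensions-zero : ∀ v w i → extensions v 0 i ≡ extensions w 0 i
extensions-zero v w zero    = trans (nC0≡1 v) (sym (nC0≡1 w))
extensions-zero v w (suc i) = refl

extensions-pascal : ∀ w k i → extensions w k i + extensions w (suc k) i ≡ extensions (suc w) (suc k) i
extensions-pascal w k       zero    = nCk+nC[k+1]≡[n+1]C[k+1] w k
extensions-pascal w zero    (suc i) = extensions-zero w (suc w) i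
extensions-pascal w (suc k) (suc i) = extensions-pascal w k i

bit : Bool → ℕ
bit b = if b then 1 else 0

count : ∀ {A : Set} → (A → Bool) → List A → ℕ
count P []       = 0
count P (x ∷ xs) = bit (P x) + count P xs

count-map : ∀ {A B : Set} (P : B → Bool) (f : A → B) xs → count P (map f xs) ≡ count (P ∘ f) xs
count-map P f []       = refl
count-map P f (x ∷ xs) = cong (_+_ (bit (P (f x)))) (count-map P f xs)

count-++ : ∀ {A : Set} (P : A → Bool) xs ys → count P (xs ++ ys) ≡ count P xs + count P ys
count-++ P []       ys = refl
count-++ P (x ∷ xs) ys =
  trans (cong (_+_ (bit (P x))) (count-++ P xs ys)) (sym (ℕ.+-assoc (bit (P x)) _ _))

count-0 : ∀ {A : Set} {P : A → Bool} xs → (∀ x → P x ≡ false) → count P xs ≡ 0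
count-0 []       P≡false = refl
count-0 (x ∷ xs) P≡false rewrite P≡false x = count-0 xs P≡false

between : ∀ {n k} → Subset n → Subset n → KSubset n k → Bool
between A B (K , _) = does (A ⊆? K ×-dec K ⊆? B)

count-kSubsets : ∀ {n k} (P : KSubset (suc n) (suc k) → Bool) →
  count P (kSubsets (suc n) (suc k))
    ≡ count (P ∘ addInside) (kSubsets n k) + count (P ∘ addOutside) (kSubsets n (suc k))
count-kSubsets {n} {k} P = trans
  (count-++ P (map addInside (kSubsets n k)) (map addOutside (kSubsets n (suc k))))
  (cong₂ _+_ (count-map P addInside (kSubsets n k)) (count-map P addOutside (kSubsets n (suc k))))

-- A point of I must be taken and a point of J left out, so only points of W branch, and that
-- branching is Pascal's rule.
count-between : ∀ {n i j w} {I J : Subset n} → Split I J i j w → ∀ k →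
  count (between I (∁ J)) (kSubsets n k) ≡ extensions w k i
count-between []      zero    = refl
count-between []      (suc k) = refl
count-between (inI {n} σ) zero = trans (count-map _ addOutside (kSubsets n 0))
  (count-0 (kSubsets n 0) (λ _ → refl))
count-between (inI {n} {I = I} {J} σ) (suc k) = trans (count-kSubsets {n} {k} _) (trans
  (cong₂ _+_ (count-between σ k) (count-0 (kSubsets n (suc k)) (λ _ → refl)))
  (ℕ.+-identityʳ _))
count-between (inJ {n} σ) zero = trans (count-map _ addOutside (kSubsets n 0)) (count-between σ 0)
count-between (inJ {n} {I = I} σ) (suc k) = trans (count-kSubsets {n} {k} _)
  (cong₂ _+_ (count-0 (kSubsets n k) (λ (K , _) → ∧-zeroʳ (I ⊆ᵇ K))) (count-between σ (suc k)))
count-between (inW {n} {i = i} {w = w} σ) zero = trans (count-map _ addOutside (kSubsets n 0))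
  (trans (count-between σ 0) (extensions-zero w (suc w) i))
count-between (inW {n} {i = i} {w = w} σ) (suc k) = trans (count-kSubsets {n} {k} _)
  (trans (cong₂ _+_ (count-between σ k) (count-between σ (suc k))) (extensions-pascal w k i))

-- From real and rational comparisons to natural numbers.

-- Normalised fractions hide numerator and denominator behind a gcd; cross-multiplication is read
-- off the unnormalised ones.
toℚᵘ-/ : ∀ a b .{{_ : ℕ.NonZero b}} → ℚ.toℚᵘ (ℤ.+ a ℚ./ b) ℚᵘ.≃ (ℤ.+ a ℚᵘ./ b)
toℚᵘ-/ a (suc b) = ℚ.toℚᵘ-fromℚᵘ (ℚᵘ.mkℚᵘ (ℤ.+ a) b)

/-<⇒ : ∀ {a b c d} .{{_ : ℕ.NonZero b}} .{{_ : ℕ.NonZero d}} →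
  ℤ.+ a ℚ./ b ℚ.< ℤ.+ c ℚ./ d → a * d < c * b
/-<⇒ {a} {b@(suc _)} {c} {d@(suc _)} p
  with ℚᵘ.<-respˡ-≃ (toℚᵘ-/ a b) (ℚᵘ.<-respʳ-≃ (toℚᵘ-/ c d) (ℚ.toℚᵘ-mono-< p))
... | ℚᵘ.*<* q = ℤ.drop‿+<+ (subst₂ ℤ._<_ (sym (ℤ.pos-* a d)) (sym (ℤ.pos-* c b)) q)

/-<⇐ : ∀ {a b c d} .{{_ : ℕ.NonZero b}} .{{_ : ℕ.NonZero d}} →
  a * d < c * b → ℤ.+ a ℚ./ b ℚ.< ℤ.+ c ℚ./ d
/-<⇐ {a} {b@(suc _)} {c} {d@(suc _)} p = ℚ.toℚᵘ-cancel-<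
  (ℚᵘ.<-respˡ-≃ (ℚᵘ.≃-sym (toℚᵘ-/ a b)) (ℚᵘ.<-respʳ-≃ (ℚᵘ.≃-sym (toℚᵘ-/ c d))
    (ℚᵘ.*<* (subst₂ ℤ._<_ (ℤ.pos-* a d) (ℤ.pos-* c b) (ℤ.+<+ p)))))

/-≡⇒ : ∀ {a b c d} .{{_ : ℕ.NonZero b}} .{{_ : ℕ.NonZero d}} →
  ℤ.+ a ℚ./ b ≡ ℤ.+ c ℚ./ d → a * d ≡ c * b
/-≡⇒ {a} {b@(suc _)} {c} {d@(suc _)} p
  with ℚᵘ.≃-trans (ℚᵘ.≃-sym (toℚᵘ-/ a b)) (ℚᵘ.≃-trans (ℚᵘ.≃-reflexive (cong ℚ.toℚᵘ p)) (toℚᵘ-/ c d))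
... | ℚᵘ.*≡* q = ℤ.+-injective (trans (ℤ.pos-* a d) (trans q (sym (ℤ.pos-* c b))))

/-≡⇐ : ∀ {a b c d} .{{_ : ℕ.NonZero b}} .{{_ : ℕ.NonZero d}} →
  a * d ≡ c * b → ℤ.+ a ℚ./ b ≡ ℤ.+ c ℚ./ d
/-≡⇐ {a} {b@(suc _)} {c} {d@(suc _)} p = ℚ.toℚᵘ-injective
  (ℚᵘ.≃-trans (toℚᵘ-/ a b) (ℚᵘ.≃-trans
    (ℚᵘ.*≡* (trans (sym (ℤ.pos-* a d)) (trans (cong ℤ.+_ p) (ℤ.pos-* c b))))
    (ℚᵘ.≃-sym (toℚᵘ-/ c d))))

infix 8 _/1
_/1 : ℕ → ℚ
m /1 = ℤ.+ m ℚ./ 1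

/1-+ : ∀ a b → a /1 ℚ.+ b /1 ≡ (a + b) /1
/1-+ a b = ℚ.toℚᵘ-injective (begin
  ℚ.toℚᵘ (a /1 ℚ.+ b /1)            ≈⟨ ℚ.toℚᵘ-homo-+ (a /1) (b /1) ⟩
  ℚ.toℚᵘ (a /1) ℚᵘ.+ ℚ.toℚᵘ (b /1)  ≈⟨ ℚᵘ.+-cong (toℚᵘ-/ a 1) (toℚᵘ-/ b 1) ⟩
  ℤ.+ a ℚᵘ./ 1 ℚᵘ.+ ℤ.+ b ℚᵘ./ 1        ≈⟨ ℚᵘ.*≡* (cong (ℤ._* ℤ.+ 1) (cong₂ ℤ._+_ (ℤ.*-identityʳ (ℤ.+ a)) (ℤ.*-identityʳ (ℤ.+ b)))) ⟩
  ℤ.+ (a + b) ℚᵘ./ 1                  ≈⟨ toℚᵘ-/ (a + b) 1 ⟨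
  ℚ.toℚᵘ ((a + b) /1)               ∎)
  where open ℚᵘ.≃-Reasoning

bit-/1 : ∀ b N → seq (if b then 1ℝ else 0ℝ) N ≡ bit b /1
bit-/1 true  N = refl
bit-/1 false N = refl

∑ℚ-bits : ∀ {A : Set} (P Q : A → Bool) {f : A → ℚ} xs →
  (∀ x → f x ≡ bit (P x) /1 ℚ.+ bit (Q x) /1) →
  ∑ℚ xs f ≡ (count P xs + count Q xs) /1
∑ℚ-bits P Q         []       f≡ = refl
∑ℚ-bits P Q {f = f} (x ∷ xs) f≡ = begin
  f x ℚ.+ ∑ℚ xs f
    ≡⟨ cong₂ ℚ._+_ (f≡ x) (∑ℚ-bits P Q xs f≡) ⟩
  bit (P x) /1 ℚ.+ bit (Q x) /1 ℚ.+ (p + q) /1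
    ≡⟨ cong (ℚ._+ (p + q) /1) (/1-+ (bit (P x)) (bit (Q x))) ⟩
  (bit (P x) + bit (Q x)) /1 ℚ.+ (p + q) /1
    ≡⟨ /1-+ (bit (P x) + bit (Q x)) (p + q) ⟩
  (bit (P x) + bit (Q x) + (p + q)) /1
    ≡⟨ cong _/1 (interchange (bit (P x)) (bit (Q x)) p q) ⟩
  (bit (P x) + p + (bit (Q x) + q)) /1 ∎
  where
  open ≡-Reasoning
  p = count P xs
  q = count Q xs
  interchange : ∀ b d p q → b + d + (p + q) ≡ b + p + (d + q)
  interchange = solve-∀

-- The size is a constant sequence with a natural value, so comparing it with a binomial coefficient
-- becomes arithmetic in ℕ.
seq-size : ∀ {n i j w} {I J : Subset n} → Split I J i j w → ∀ k N →
  seq (size (paired k I J)) N ≡ (extensions w k i + extensions w k j) /1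
seq-size {n} {I = I} {J} σ k N = trans (seq-∑ (kSubsets n k) (paired k I J) N) (trans
  (∑ℚ-bits (between I (∁ J)) (between J (∁ I)) (kSubsets n k) (λ K →
    cong₂ ℚ._+_ (bit-/1 (between I (∁ J) K) N) (bit-/1 (between J (∁ I) K) N)))
  (cong _/1 (cong₂ _+_ (count-between σ k) (count-between (split-swap σ) k))))

module _ {x : ℝ} {a : ℕ} (x≡a : ∀ N → seq x N ≡ a /1) where

  <ℝ⇒< : ∀ {b} → x <ℝ fromℕ b → a < b
  <ℝ⇒< {b} (ε , 0<ε , N , p) = subst₂ _<_ (ℕ.*-identityʳ a) (ℕ.*-identityʳ b)
    (/-<⇒ {a} {1} {b} {1} (ℚ.<-trans
      (subst (ℚ._< a /1 ℚ.+ ε) (ℚ.+-identityʳ (a /1)) (ℚ.+-monoʳ-< (a /1) 0<ε))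
      (subst (λ q → q ℚ.+ ε ℚ.< b /1) (x≡a N) (p N ℕ.≤-refl))))

  <⇒<ℝ : ∀ {b} → a < b → x <ℝ fromℕ b
  -- Naturals a < b differ by at least 1, so ½ is a uniform gap that keeps the inequality strict.
  <⇒<ℝ {b} a<b = ℚ.½ , ℚ.positive⁻¹ ℚ.½ , 0 , λ n _ →
    subst (λ q → q ℚ.+ ℚ.½ ℚ.< b /1) (sym (x≡a n)) (ℚ.<-≤-trans
      (ℚ.+-monoʳ-< (a /1) (ℚ.*<* (ℤ.+<+ (s≤s (s≤s z≤n)))))
      (subst (ℚ._≤ b /1) (trans (cong _/1 (ℕ.+-comm 1 a)) (sym (/1-+ a 1))) (/1-mono-≤ a<b)))
    where
    /1-mono-≤ : ∀ {a b} → a ≤ b → a /1 ℚ.≤ b /1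
    /1-mono-≤ {a} {b} a≤b with ℕ.m≤n⇒m<n∨m≡n a≤b
    ... | inj₁ a<b  = ℚ.<⇒≤ (/-<⇐ {a} {1} {b} {1} (ℕ.*-monoˡ-< 1 a<b))
    ... | inj₂ refl = ℚ.≤-refl

  ≡⇒≈ : ∀ {b} → a ≡ b → x ≈ fromℕ b
  ≡⇒≈ refl ε 0<ε = 0 , λ n _ → subst (ℚ._< ε)
    (sym (trans (cong (λ q → ℚ.∣ q ℚ.- a /1 ∣) (x≡a n)) (cong ℚ.∣_∣ (ℚ.+-inverseʳ (a /1))))) 0<ε

  ≈⇒≡ : ∀ {b} → x ≈ fromℕ b → a ≡ b
  ≈⇒≡ {b} x≈b with a /1 ℚ.≟ b /1
  ... | yes eq = ℕ.*-cancelʳ-≡ a b 1 (/-≡⇒ {a} {1} {b} {1} eq)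
  ... | no neq = contradiction refl (ℚ.<⇒≢ (subst (λ q → dist q (b /1) ℚ.< ε) (x≡a N) (p N ℕ.≤-refl)))
    where
    -- If a and b differed, their own distance would be an admissible tolerance, hence smaller than
    -- itself.
    ε = dist (a /1) (b /1)
    ε≰0 : ¬ ε ℚ.≤ 0ℚ
    ε≰0 ε≤0 = neq (x∙y⁻¹≈ε⇒x≈y ℚ.+-0-group (a /1) (b /1)
      (ℚ.∣p∣≡0⇒p≡0 _ (ℚ.≤-antisym ε≤0 (ℚ.0≤∣p∣ (a /1 ℚ.- b /1)))))
    close = x≈b ε (ℚ.≰⇒> ε≰0)
    N = proj₁ close
    p = proj₂ close

-- Which sizes i and j are compatible with degree t.

between-false : ∀ {n k} (A B : Subset n) → ¬ (∣ A ∣ ≤ k × k ≤ ∣ B ∣) →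
  ∀ (K : KSubset n k) → between A B K ≡ false
between-false A B empty (K , refl) = dec-false (A ⊆? K ×-dec K ⊆? B)
  (λ (A⊆K , K⊆B) → empty (p⊆q⇒∣p∣≤∣q∣ A⊆K , p⊆q⇒∣p∣≤∣q∣ K⊆B))

-- The size conditions for a k-set to contain a set of size i and avoid a disjoint one of size j.
Fits : ℕ → ℕ → ℕ → ℕ → Set
Fits n k i j = i ≤ k × j + k ≤ n

between-I-∁J-false : ∀ {n k} (I J : Subset n) → ¬ Fits n k (∣ I ∣) (∣ J ∣) →
  ∀ (K : KSubset n k) → between I (∁ J) K ≡ false
between-I-∁J-false {n} {k} I J ¬fits = between-false I (∁ J) λ (i≤k , k≤∣∁J∣) →
  ¬fits (i≤k , subst (∣ J ∣ + k ≤_) (ℕ.m+[n∸m]≡n (∣p∣≤n J))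
    (ℕ.+-monoʳ-≤ ∣ J ∣ (subst (k ≤_) (∣∁p∣≡n∸∣p∣ J) k≤∣∁J∣)))

paired-nonzero : ∀ {n} k (I J : Subset n) → ¬ IsZero (paired k I J) →
  Fits n k (∣ I ∣) (∣ J ∣) ⊎ Fits n k (∣ J ∣) (∣ I ∣)
paired-nonzero {n} k I J p≢0
  with (∣ I ∣ ℕ.≤? k) ×-dec (∣ J ∣ + k ℕ.≤? n) | (∣ J ∣ ℕ.≤? k) ×-dec (∣ I ∣ + k ℕ.≤? n)
... | yes fits | _        = inj₁ fits
... | no _     | yes fits = inj₂ fits
... | no ¬f    | no ¬g    = contradiction (λ K → ≡⇒≈ {paired k I J K} {0} (zeroes K) refl) p≢0
  where
  zeroes : ∀ K N → seq (paired k I J K) N ≡ 0 /1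
  zeroes K N = cong₂ ℚ._+_
    (trans (bit-/1 (between I (∁ J) K) N) (cong (λ b → bit b /1) (between-I-∁J-false I J ¬f K)))
    (trans (bit-/1 (between J (∁ I) K) N) (cong (λ b → bit b /1) (between-I-∁J-false J I ¬g K)))

≈-respˡ : ∀ x y z → (∀ N → seq x N ≡ seq y N) → x ≈ z → y ≈ z
≈-respˡ x y z x≡y x≈z ε 0<ε with x≈z ε 0<ε
... | N , close = N , λ m N≤m → subst (λ q → dist q (seq z m) ℚ.< ε) (x≡y m) (close m N≤m)

combination-comm : ∀ {n k t} (I J : Subset n) →
  IsPencilCombination t (paired k I J) → IsPencilCombination t (paired k J I)
combination-comm {n} {k} {t} I J (a , p≈) = a , λ K →
  ≈-respˡ (paired k I J K) (paired k J I K) (∑ (kSubsets n t) (λ T → a T *ℝ pencil k (proj₁ T) K))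
    (λ N → ℚ.+-comm (seq (basic k I (∁ J) K) N) (seq (basic k J (∁ I) K) N)) (p≈ K)

deg≤-comm : ∀ {n k t} (I J : Subset n) → Deg≤ k t I J → Deg≤ k t J I
deg≤-comm {n} {k} {t} I J deg =
  deg≤⁺ {n} {k} {t} {J} {I} (combination-comm I J (deg≤⁻ {n} {k} {t} {I} {J} deg))

pattern′ : ∀ {m d i j w k} u a b p q r o →
  m ≡ u + (a + b) → d ≡ p + q → i ≡ u + (a + p) → j ≡ u + (b + q) →
  w ≡ a + (b + (r + o)) → k ≡ u + (a + (b + (p + r))) → Pattern m d i j w k
pattern′ u a b p q r o refl refl refl refl refl refl = pattern-of u a b p q r o

module _ {n k t i j w : ℕ} {I J : Subset n}
  (σ : Split I J i j w) (comb : Deg≤ k t I J) where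

  private
    i+j+w≡n = split-sum σ

  -- Every point of I and J gets a partner in W, which is large enough: w = n - i - j ≥ 2k - i - j ≥
  -- i + j. Then r = k - i - j further points of W complete K.
  small-even : 2 * k ≤ n → i + j ≤ k → 2 ∣ i + j → i + j ≤ t
  small-even 2k≤n i+j≤k even with ℕ.m≤n⇒∃[o]m+o≡n i+j≤k | ℕ.m≤n⇒∃[o]m+o≡n 2k≤n
  ... | r , refl | d , 2k+d≡n = degree≥-tight σ
    (pattern′ 0 i j 0 0 r (r + d) refl refl (sym (ℕ.+-identityʳ i)) (sym (ℕ.+-identityʳ j))
      w≡ (ℕ.+-assoc i j r)) even comb
    where
    rearrange : ∀ i j r d → 2 * (i + j + r) + d ≡ i + j + (i + (j + (r + (r + d))))
    rearrange = solve-∀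
    w≡ : w ≡ i + (j + (r + (r + d)))
    w≡ = ℕ.+-cancelˡ-≡ (i + j) _ _
      (trans i+j+w≡n (trans (sym 2k+d≡n) (rearrange i j r d)))

-- One point of I or J is left without a partner, so that the odd number of points does not cause
-- cancellation. An unpaired point of J stays outside K and a further point of W replaces it there;
-- an unpaired point of I is itself in K.
small-odd : ∀ {n k t i j w s} {I J : Subset n} → Split I J i j w →
  Deg≤ k t I J → 2 * k ≤ n → i + j ≤ k → i + j ≡ suc s → s ≤ t
small-odd {i = zero} {suc j} {w} σ comb 2k≤n i+j≤k refl
  with ℕ.m≤n⇒∃[o]m+o≡n i+j≤k | ℕ.m≤n⇒∃[o]m+o≡n 2k≤n
... | r , refl | d , 2k+d≡n = degree≥-loose σ
    (pattern′ 0 0 j 0 1 (suc r) (r + d) refl refl refl (ℕ.+-comm 1 j) w≡ (sym (ℕ.+-suc j r))) comb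
    where
    rearrange : ∀ j r d → 2 * (suc j + r) + d ≡ suc j + (j + (suc r + (r + d)))
    rearrange = solve-∀
    w≡ : w ≡ j + (suc r + (r + d))
    w≡ = ℕ.+-cancelˡ-≡ (suc j) _ _
      (trans (split-sum σ) (trans (sym 2k+d≡n) (rearrange j r d)))
small-odd {i = suc i} {j} {w} σ comb 2k≤n i+j≤k refl
  with ℕ.m≤n⇒∃[o]m+o≡n i+j≤k | ℕ.m≤n⇒∃[o]m+o≡n 2k≤n
... | r , refl | d , 2k+d≡n = degree≥-loose σ
    (pattern′ 0 i j 1 0 r (suc r + d) refl refl (ℕ.+-comm 1 i) (sym (ℕ.+-identityʳ j)) w≡ (k≡ i j r)) comb
    where
    k≡ : ∀ i j r → suc i + j + r ≡ i + (j + (1 + r))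
    k≡ = solve-∀
    rearrange : ∀ i j r d → 2 * (suc i + j + r) + d ≡ suc i + j + (i + (j + (r + (suc r + d))))
    rearrange = solve-∀
    w≡ : w ≡ i + (j + (r + (suc r + d)))
    w≡ = ℕ.+-cancelˡ-≡ (suc i + j) _ _
      (trans (split-sum σ) (trans (sym 2k+d≡n) (rearrange i j r d)))

-- The ground set splits into u + 1 pairs I–J, a pairs I–W and b pairs J–W.
record Antipodal (i j w k : ℕ) : Set where
  field
    {u a b} : ℕ
    i≡ : i ≡ suc u + a
    j≡ : j ≡ suc u + b
    w≡ : w ≡ a + b
    k≡ : k ≡ suc u + (a + b)

-- Here a = k - j, b = k - i and u + 1 = i + j - k. Since w = 2k - i - j = a + b, the pairs exhaust
-- V.
antipodal-pairs : ∀ {n i j w k} {I J : Subset n} → Split I J i j w → n ≡ 2 * k → i ≤ k → j ≤ k → k < i + j →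
  Antipodal i j w k
antipodal-pairs {n} {i} {j} {w} {k} σ n≡2k i≤k j≤k k<i+j
  with ℕ.m≤n⇒∃[o]m+o≡n i≤k | ℕ.m≤n⇒∃[o]m+o≡n j≤k | ℕ.m≤n⇒∃[o]m+o≡n k<i+j
... | b , i+b≡k | a , j+a≡k | u , 1+k+u≡i+j = record { u = u; a = a; b = b; i≡ = i≡ ; j≡ = j≡ ; w≡ = w≡ ; k≡ = k≡ }
  where
  i≡ : i ≡ suc u + a
  i≡ = ℕ.+-cancelʳ-≡ j _ _ (trans (sym 1+k+u≡i+j)
    (trans (cong (λ k → suc (k + u)) (sym j+a≡k)) (arith j a u)))
    where
    arith : ∀ j a u → suc (j + a + u) ≡ suc u + a + j
    arith = solve-∀
  j≡ : j ≡ suc u + b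
  j≡ = ℕ.+-cancelˡ-≡ i _ _ (trans (sym 1+k+u≡i+j)
    (trans (cong (λ k → suc (k + u)) (sym i+b≡k)) (arith i b u)))
    where
    arith : ∀ i b u → suc (i + b + u) ≡ i + (suc u + b)
    arith = solve-∀
  k≡ : k ≡ suc u + (a + b)
  k≡ = trans (sym i+b≡k) (trans (cong (_+ b) i≡) (ℕ.+-assoc (suc u) a b))
  w≡ : w ≡ a + b
  w≡ = ℕ.+-cancelˡ-≡ (i + j) _ _ (trans (split-sum σ) (trans n≡2k
    (trans (cong (2 *_) k≡) (trans (arith u a b) (sym (cong₂ (λ i j → i + j + (a + b)) i≡ j≡))))))
    where
    arith : ∀ u a b → 2 * (suc u + (a + b)) ≡ suc u + a + (suc u + b) + (a + b)
    arith = solve-∀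

module _ {n k t i j w : ℕ} {I J : Subset n}
  (σ : Split I J i j w) (comb : Deg≤ k t I J) where

  private
    i+j+w≡n = split-sum σ

  antipodal-even : Antipodal i j w k → 2 ∣ k → k ≤ t
  antipodal-even A even = degree≥-tight σ
    (pattern′ (suc u) a b 0 0 0 0 k≡ refl
      (trans i≡ (cong (suc u +_) (sym (ℕ.+-identityʳ a))))
      (trans j≡ (cong (suc u +_) (sym (ℕ.+-identityʳ b))))
      (trans w≡ (cong (a +_) (sym (ℕ.+-identityʳ b))))
      (trans k≡ (cong (λ b → suc u + (a + b)) (sym (ℕ.+-identityʳ b))))) even comb
    where open Antipodal A

  -- Breaking up one I-J pair, which exists because k < i + j, leaves k - 1 pairs and a loose
  -- pattern, valid for every parity.
  antipodal-any : Antipodal i j w k → k ≤ suc t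
  antipodal-any A = subst (_≤ suc t) (sym k≡) (s≤s (degree≥-loose σ
    (pattern′ u a b 1 1 0 0 refl refl
      (trans i≡ (shift u a)) (trans j≡ (shift u b))
      (trans w≡ (cong (a +_) (sym (ℕ.+-identityʳ b))))
      (trans k≡ (trans (shift u (a + b)) (cong (u +_) (ℕ.+-assoc a b 1))))) comb))
    where
    open Antipodal A
    shift : ∀ u a → suc u + a ≡ u + (a + 1)
    shift = solve-∀

  -- For j ≤ k, the spare point of W given by n > 2k takes over the I-point of one I-J pair of the
  -- antipodal pairing: there are still k pairs, but a point of J is now unpaired, so parity does
  -- not matter. For j > k, J has points to spare anyway: i of them go to I, k - i to W, and the
  -- rest stay out.
  large : 2 * k < n → k < i + j → Fits n k i j → k ≤ t
  large 2k<n k<i+j (i≤k , j+k≤n)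
    with ℕ.m≤n⇒∃[o]m+o≡n 2k<n | ℕ.m≤n⇒∃[o]m+o≡n i≤k
       | ℕ.m≤n⇒∃[o]m+o≡n j+k≤n | ℕ.m≤n⇒∃[o]m+o≡n k<i+j | j ℕ.≤? k
  ... | y , 1+2k+y≡n | b , i+b≡k | x , j+k+x≡n | g , 1+k+g≡i+j | yes j≤k
    with ℕ.m≤n⇒∃[o]m+o≡n j≤k
  ... | a , j+a≡k = degree≥-loose σ
    (pattern′ g (suc a) b 0 1 0 y
      (trans k≡ refl) refl (trans i≡ (cong (g +_) (sym (ℕ.+-identityʳ (suc a))))) j≡ w≡
      (trans k≡ (cong (λ b → g + (suc a + b)) (sym (ℕ.+-identityʳ b))))) comb
    where
    j≡ : j ≡ g + (b + 1)
    j≡ = ℕ.+-cancelˡ-≡ i _ _ (trans (sym 1+k+g≡i+j)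
      (trans (cong (λ k → suc (k + g)) (sym i+b≡k)) (arith i b g)))
      where
      arith : ∀ i b g → suc (i + b + g) ≡ i + (g + (b + 1))
      arith = solve-∀
    i≡ : i ≡ g + suc a
    i≡ = ℕ.+-cancelʳ-≡ j _ _ (trans (sym 1+k+g≡i+j)
      (trans (cong (λ k → suc (k + g)) (sym j+a≡k)) (arith j a g)))
      where
      arith : ∀ j a g → suc (j + a + g) ≡ g + suc a + j
      arith = solve-∀
    k≡ : k ≡ g + (suc a + b)
    k≡ = trans (sym i+b≡k) (trans (cong (_+ b) i≡) (ℕ.+-assoc g (suc a) b))
    w≡ : w ≡ suc a + (b + y)
    w≡ = ℕ.+-cancelˡ-≡ (i + j) _ _ (trans i+j+w≡n (trans (sym 1+2k+y≡n)
      (trans (cong (λ k → suc (2 * k) + y) k≡) (trans (arith g a b y)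
        (sym (cong₂ (λ i j → i + j + (suc a + (b + y))) i≡ j≡))))))
      where
      arith : ∀ g a b y → suc (2 * (g + (suc a + b))) + y ≡ g + suc a + (g + (b + 1)) + (suc a + (b + y))
      arith = solve-∀
  large 2k<n k<i+j (i≤k , j+k≤n)
      | y , 1+2k+y≡n | b , i+b≡k | x , j+k+x≡n | g , 1+k+g≡i+j | no j≰k
    with ℕ.m≤n⇒∃[o]m+o≡n (ℕ.≰⇒> j≰k)
  ... | q , 1+k+q≡j = degree≥-loose σ
    (pattern′ i 0 b 0 (suc q) 0 x (sym i+b≡k) refl (sym (ℕ.+-identityʳ i)) j≡ w≡
      (trans (sym i+b≡k) (cong (i +_) (sym (ℕ.+-identityʳ b))))) comb
    where
    j≡ : j ≡ i + (b + suc q)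
    j≡ = trans (sym 1+k+q≡j) (trans (cong (λ k → suc (k + q)) (sym i+b≡k)) (arith i b q))
      where
      arith : ∀ i b q → suc (i + b + q) ≡ i + (b + suc q)
      arith = solve-∀
    w≡ : w ≡ b + x
    w≡ = ℕ.+-cancelˡ-≡ (i + j) _ _ (trans i+j+w≡n (trans (sym j+k+x≡n)
      (trans (cong (λ k → j + k + x) (sym i+b≡k)) (arith i j b x))))
      where
      arith : ∀ i j b x → j + (i + b) + x ≡ i + j + (b + x)
      arith = solve-∀

even⊎odd : ∀ m → (2 ∣ m) ⊎ ∃[ h ] (m ≡ suc h × 2 ∣ h)
even⊎odd zero = inj₁ (divides 0 refl)
even⊎odd (suc m) with even⊎odd m
... | inj₁ even                      = inj₂ (m , refl , even)
... | inj₂ (h , refl , divides q eq) = inj₁ (divides (suc q) (cong (λ h → suc (suc h)) eq))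

data Shape (n k t i j : ℕ) : Set where
  low       : i + j ≤ t → Shape n k t i j
  critical  : i + j ≡ suc t → 2 ∣ t → Shape n k t i j
  antipodal : n ≡ 2 * k → k ≡ suc t → 2 ∣ t → k < i + j → i ≤ k → j ≤ k → Shape n k t i j

shape : ∀ {n k t w} (I J : Subset n) → Split I J (∣ I ∣) (∣ J ∣) w → 2 * k ≤ n → t < k →
  ¬ IsZero (paired k I J) → Deg≤ k t I J → Shape n k t (∣ I ∣) (∣ J ∣)
shape {n} {k} {t} I J σ 2k≤n t<k p≢0 comb with ∣ I ∣ + ∣ J ∣ ℕ.≤? k
... | yes s≤k with even⊎odd (∣ I ∣ + ∣ J ∣)
...   | inj₁ even = low (small-even σ comb 2k≤n s≤k even)
...   | inj₂ (s , eq , even) with ℕ.m≤n⇒m<n∨m≡n (small-odd σ comb 2k≤n s≤k eq)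
...     | inj₁ s<t  = low (subst (_≤ t) (sym eq) s<t)
-- Here t is the even predecessor of i + j; this is the source of the parity condition in this
-- shape.
...     | inj₂ refl = critical eq even
shape {n} {k} {t} I J σ 2k≤n t<k p≢0 comb | no s≰k with ℕ.m≤n⇒m<n∨m≡n 2k≤n
... | inj₁ 2k<n with paired-nonzero k I J p≢0
...   | inj₁ fits = contradiction (large σ comb 2k<n (ℕ.≰⇒> s≰k) fits) (ℕ.<⇒≱ t<k)
...   | inj₂ fits = contradiction
  (large (split-swap σ) (deg≤-comm I J comb) 2k<n
    (subst (k <_) (ℕ.+-comm (∣ I ∣) (∣ J ∣)) (ℕ.≰⇒> s≰k)) fits) (ℕ.<⇒≱ t<k)
shape {n} {k} {t} {w} I J σ 2k≤n t<k p≢0 comb | no s≰k | inj₂ 2k≡n = result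
  where
  -- For n = 2k the condition l + k ≤ n in `Fits` is l ≤ k, so both sizes are at most k.
  cancel : ∀ {l} → l + k ≤ n → l ≤ k
  cancel {l} p = ℕ.+-cancelʳ-≤ k l k (subst (l + k ≤_)
    (trans (sym 2k≡n) (cong (k +_) (ℕ.+-identityʳ k))) p)
  bounds : ∣ I ∣ ≤ k × ∣ J ∣ ≤ k
  bounds with paired-nonzero k I J p≢0
  ... | inj₁ (i≤k , j+k≤n) = i≤k , cancel j+k≤n
  ... | inj₂ (j≤k , i+k≤n) = cancel i+k≤n , j≤k
  A : Antipodal (∣ I ∣) (∣ J ∣) w k
  A = antipodal-pairs σ (sym 2k≡n) (proj₁ bounds) (proj₂ bounds) (ℕ.≰⇒> s≰k)
  k≡1+t : k ≡ suc t
  k≡1+t = ℕ.≤-antisym (antipodal-any σ comb A) t<k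
  result : Shape n k t (∣ I ∣) (∣ J ∣)
  result with even⊎odd k
  ... | inj₁ even = contradiction (antipodal-even σ comb A even) (ℕ.<⇒≱ t<k)
  ... | inj₂ (h , refl , even) = antipodal (sym 2k≡n) k≡1+t
    (subst (2 ∣_) (ℕ.suc-injective k≡1+t) even) (ℕ.≰⇒> s≰k) (proj₁ bounds) (proj₂ bounds)

-- Binomial inequalities and the comparison of sizes.

C-pos : ∀ {m a} → a ≤ m → 0 < m C a
C-pos {m}     {zero}  z≤n       = subst (0 <_) (sym (nC0≡1 m)) (s≤s z≤n)
C-pos {suc m} {suc a} (s≤s a≤m) = subst (0 <_) (nCk+nC[k+1]≡[n+1]C[k+1] m a)
  (ℕ.≤-trans (C-pos a≤m) (ℕ.m≤m+n _ _))

-- After two applications of Pascal's rule, the summands are compared crosswise.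
C-mono-≤ : ∀ {m a b} → a ≤ b → a + b ≤ m → m C a ≤ m C b
C-mono-≤ {m} {zero} {b} _ b≤m = subst (_≤ m C b) (sym (nC0≡1 m)) (C-pos b≤m)
C-mono-≤ {suc m} {suc a} {suc b} (s≤s a≤b) (s≤s a+1+b≤m) with ℕ.m≤n⇒m<n∨m≡n a≤b
... | inj₂ refl = ℕ.≤-refl
... | inj₁ a<b  = subst₂ _≤_ (nCk+nC[k+1]≡[n+1]C[k+1] m a)
  (trans (ℕ.+-comm (m C suc b) (m C b)) (nCk+nC[k+1]≡[n+1]C[k+1] m b))
  (ℕ.+-mono-≤ (C-mono-≤ (ℕ.m≤n⇒m≤1+n a≤b) a+1+b≤m)
    (C-mono-≤ a<b (subst (_≤ m) (ℕ.+-suc a b) a+1+b≤m)))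

-- In the crosswise comparison one pair of summands is strict; the other may be an equality, as when
-- b = a + 1.
C-mono-< : ∀ {m a b} → a < b → a + b < m → m C a < m C b
C-mono-< {suc m} {zero} {suc b} _ (s≤s 1+b≤m) = subst₂ _<_ (sym (nC0≡1 (suc m)))
  (nCk+nC[k+1]≡[n+1]C[k+1] m b) (ℕ.+-mono-≤ (C-pos (ℕ.<⇒≤ 1+b≤m)) (C-pos 1+b≤m))
C-mono-< {suc m} {suc a} {suc b} (s≤s a<b) (s≤s a+1+b<m) = subst₂ _<_
  (nCk+nC[k+1]≡[n+1]C[k+1] m a)
  (trans (ℕ.+-comm (m C suc b) (m C b)) (nCk+nC[k+1]≡[n+1]C[k+1] m b))
  (ℕ.+-mono-<-≤ (C-mono-< (ℕ.m<n⇒m<1+n a<b) a+1+b<m)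
    (C-mono-≤ a<b (subst (_≤ m) (ℕ.+-suc a b) (ℕ.<⇒≤ a+1+b<m))))

C-diagonal-≤ : ∀ v {m a} → m C a ≤ (v + m) C (v + a)
C-diagonal-≤ zero = ℕ.≤-refl
C-diagonal-≤ (suc v) {m} {a} = ℕ.≤-trans (C-diagonal-≤ v {m} {a})
  (subst ((v + m) C (v + a) ≤_) (nCk+nC[k+1]≡[n+1]C[k+1] (v + m) (v + a)) (ℕ.m≤m+n _ _))

C-sym : ∀ {m} a b → a + b ≡ m → m C a ≡ m C b
C-sym a b refl = trans (nCk≡nC[n∸k] (ℕ.m≤m+n a b)) (cong ((a + b) C_) (ℕ.m+n∸m≡n a b))

extensions-≡ : ∀ w {k} i e → k ≡ i + e → extensions w k i ≡ w C e
extensions-≡ w zero    e refl = refl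
extensions-≡ w (suc i) e refl = extensions-≡ w i e refl

pencil-≡ : ∀ {n k} t {m e} → n ≡ t + m → k ≡ t + e → (n ∸ t) C (k ∸ t) ≡ m C e
pencil-≡ t {m} {e} refl refl = cong₂ _C_ (ℕ.m+n∸m≡n t m) (ℕ.m+n∸m≡n t e)

∸-∸-≡ : ∀ a b {w n} → a + b + w ≡ n → n ∸ a ∸ b ≡ w
∸-∸-≡ a b {w} refl = trans (ℕ.∸-+-assoc (a + b + w) a b) (ℕ.m+n∸m≡n (a + b) w)

-- A t-pencil is no larger than an (i + j)-pencil, which by unimodality is no larger than the first
-- summand of the size; the second summand is positive. In the chain `m` is n - t, `v` is t - i - j
-- and `suc e` is k - t.
low⇒> : ∀ {n k t i j w} → i + j + w ≡ n → 2 * k ≤ n → t < k → i + j ≤ t →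
  (n ∸ t) C (k ∸ t) < extensions w k i + extensions w k j
low⇒> {n} {k} {t} {i} {j} {w} i+j+w≡n 2k≤n t<k i+j≤t
  with ℕ.m≤n⇒∃[o]m+o≡n i+j≤t | ℕ.m≤n⇒∃[o]m+o≡n t<k | ℕ.m≤n⇒∃[o]m+o≡n 2k≤n
... | v , refl | e , refl | d , refl = subst₂ _<_
  (sym (pencil-≡ t {m} {suc e} (n≡ i j v e d) (k≡ i j v e)))
  (sym (cong₂ _+_ (extensions-≡ w i (j + (v + suc e)) (kᵢ≡ i j v e))
                  (extensions-≡ w j (i + (v + suc e)) (kⱼ≡ i j v e))))
  (begin-strict
    m C suc e                                  ≤⟨ C-diagonal-≤ v ⟩
    (v + m) C (v + suc e)                      ≡⟨ cong (_C (v + suc e)) (sym w≡) ⟩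
    w C (v + suc e)                            ≤⟨ C-mono-≤ (ℕ.m≤n+m _ j) bound₁ ⟩
    w C (j + (v + suc e))
      <⟨ ℕ.m<m+n _ (ℕ.<-≤-trans (C-pos bound₀) (C-mono-≤ (ℕ.m≤n+m _ i) bound₂)) ⟩
    w C (j + (v + suc e)) + w C (i + (v + suc e)) ∎)
  where
  open ℕ.≤-Reasoning
  m = i + j + v + suc (suc (e + e + d))
  n≡ : ∀ i j v e d → 2 * suc (i + j + v + e) + d ≡ i + j + v + (i + j + v + suc (suc (e + e + d)))
  n≡ = solve-∀
  k≡ : ∀ i j v e → suc (i + j + v + e) ≡ i + j + v + suc e
  k≡ = solve-∀
  kᵢ≡ : ∀ i j v e → suc (i + j + v + e) ≡ i + (j + (v + suc e))
  kᵢ≡ = solve-∀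
  kⱼ≡ : ∀ i j v e → suc (i + j + v + e) ≡ j + (i + (v + suc e))
  kⱼ≡ = solve-∀
  w≡ : w ≡ v + m
  w≡ = ℕ.+-cancelˡ-≡ (i + j) _ _ (trans i+j+w≡n (arith i j v e d))
    where
    arith : ∀ i j v e d → 2 * suc (i + j + v + e) + d
      ≡ i + j + (v + (i + j + v + suc (suc (e + e + d))))
    arith = solve-∀
  bound : ∀ {x} y → x + y ≡ w → x ≤ w
  bound {x} y refl = ℕ.m≤m+n x y
  bound₀ : v + suc e ≤ w
  bound₀ = bound (i + j + v + suc (e + d)) (trans (arith i j v e d) (sym w≡))
    where
    arith : ∀ i j v e d → v + suc e + (i + j + v + suc (e + d)) ≡ v + (i + j + v + suc (suc (e + e + d)))
    arith = solve-∀
  bound₁ : v + suc e + (j + (v + suc e)) ≤ w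
  bound₁ = bound (i + d) (trans (arith i j v e d) (sym w≡))
    where
    arith : ∀ i j v e d → v + suc e + (j + (v + suc e)) + (i + d) ≡ v + (i + j + v + suc (suc (e + e + d)))
    arith = solve-∀
  bound₂ : v + suc e + (i + (v + suc e)) ≤ w
  bound₂ = bound (j + d) (trans (arith i j v e d) (sym w≡))
    where
    arith : ∀ i j v e d → v + suc e + (i + (v + suc e)) + (j + d) ≡ v + (i + j + v + suc (suc (e + e + d)))
    arith = solve-∀

-- Pascal's rule splits the pencil into two coefficients in the same row w = n - t - 1 as the two
-- summands of the size. Both sizes being positive, k - i and k - j lie far enough up the row for
-- unimodality to apply summand by summand.
critical⇒> : ∀ {n k t} i j {w} → suc i + suc j + w ≡ n → 2 * k ≤ n → t < k → suc i + suc j ≡ suc t →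
  (n ∸ t) C (k ∸ t) < extensions w k (suc i) + extensions w k (suc j)
critical⇒> {n} {k} i j {w} i+j+w≡n 2k≤n t<k refl
  with ℕ.m≤n⇒∃[o]m+o≡n t<k | ℕ.m≤n⇒∃[o]m+o≡n 2k≤n
... | e , refl | d , refl = subst₂ _<_
  (sym (trans (pencil-≡ (i + suc j) {suc w} {suc e} n≡ (k≡ i j e))
    (trans (sym (nCk+nC[k+1]≡[n+1]C[k+1] w e)) (ℕ.+-comm (w C e) (w C suc e)))))
  (sym (cong₂ _+_ (extensions-≡ w (suc i) (suc j + e) (kᵢ≡ i j e)) (extensions-≡ w (suc j) (suc i + e) (kⱼ≡ i j e))))
  (ℕ.+-mono-≤-< (C-mono-≤ (s≤s (ℕ.m≤n+m e j)) (bound (i + d) (trans (arith₁ i j e d) (sym w≡))))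
    (C-mono-< (s≤s (ℕ.m≤n+m e i)) (bound (j + d) (trans (arith₂ i j e d) (sym w≡)))))
  where
  k≡ : ∀ i j e → suc (i + suc j + e) ≡ i + suc j + suc e
  k≡ = solve-∀
  kᵢ≡ : ∀ i j e → suc (i + suc j + e) ≡ suc i + (suc j + e)
  kᵢ≡ = solve-∀
  kⱼ≡ : ∀ i j e → suc (i + suc j + e) ≡ suc j + (suc i + e)
  kⱼ≡ = solve-∀
  w≡ : w ≡ suc i + suc j + (e + e + d)
  w≡ = ℕ.+-cancelˡ-≡ (suc i + suc j) _ _ (trans i+j+w≡n (arith i j e d))
    where
    arith : ∀ i j e d → 2 * suc (i + suc j + e) + d ≡ suc i + suc j + (suc i + suc j + (e + e + d))
    arith = solve-∀
  n≡ : 2 * suc (i + suc j + e) + d ≡ i + suc j + suc w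
  n≡ = trans (sym i+j+w≡n) (sym (ℕ.+-suc (i + suc j) w))
  bound : ∀ {x} y → x + y ≡ w → x ≤ w
  bound {x} y refl = ℕ.m≤m+n x y
  arith₁ : ∀ i j e d → suc e + (suc j + e) + (i + d) ≡ suc i + suc j + (e + e + d)
  arith₁ = solve-∀
  arith₂ : ∀ i j e d → suc (e + (suc i + e)) + (j + d) ≡ suc i + suc j + (e + e + d)
  arith₂ = solve-∀

-- The sizes are t + 1 and 0, and e = k - t - 1. By Pascal's rule the pencil shares the term `w C e`
-- with the size. What remains is `w C suc e` against `w C k`, and the latter is `w C (e + d)` by
-- symmetry, with d = n - 2k. So d = 0, 1 and at least 2 give less, equal and greater.
module Extreme {n k t w : ℕ} (1≤t : 1 ≤ t) (t<k : t < k) (1+t+w≡n : suc t + w ≡ n) where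

  e : ℕ
  e = proj₁ (ℕ.m≤n⇒∃[o]m+o≡n t<k)

  k≡ : k ≡ suc t + e
  k≡ = sym (proj₂ (ℕ.m≤n⇒∃[o]m+o≡n t<k))

  size≡ : extensions w k (suc t) + extensions w k 0 ≡ w C e + w C k
  size≡ = cong (_+ w C k) (extensions-≡ w (suc t) e k≡)

  pencil≡ : (n ∸ t) C (k ∸ t) ≡ w C e + w C suc e
  pencil≡ = trans (pencil-≡ t (trans (sym 1+t+w≡n) (sym (ℕ.+-suc t w))) (trans k≡ (sym (ℕ.+-suc t e))))
    (sym (nCk+nC[k+1]≡[n+1]C[k+1] w e))

  w≡ : ∀ d → 2 * k + d ≡ n → w ≡ suc e + (t + (e + d))
  w≡ d 2k+d≡n = ℕ.+-cancelˡ-≡ (suc t) _ _ (trans 1+t+w≡n (trans (sym 2k+d≡n)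
    (trans (cong (λ k → 2 * k + d) k≡) (arith t e d))))
    where
    arith : ∀ t e d → 2 * (suc t + e) + d ≡ suc t + (suc e + (t + (e + d)))
    arith = solve-∀

  wCk≡ : ∀ d → 2 * k + d ≡ n → w C k ≡ w C (e + d)
  wCk≡ d 2k+d≡n = C-sym k (e + d) (trans (cong (_+ (e + d)) k≡) (trans (arith t e d) (sym (w≡ d 2k+d≡n))))
    where
    arith : ∀ t e d → suc t + e + (e + d) ≡ suc e + (t + (e + d))
    arith = solve-∀

  -- The room required by strict unimodality; it comes from 1 ≤ t.
  beyond : ∀ d → 2 * k + d ≡ n → ∀ {x} → x ≡ suc e + (e + d) → x < w
  beyond d 2k+d≡n refl = subst (suc (suc e + (e + d)) ≤_) (sym (w≡ d 2k+d≡n))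
    (subst (_≤ suc e + (t + (e + d))) (ℕ.+-suc (suc e) (e + d))
      (ℕ.+-monoʳ-≤ (suc e) (ℕ.+-monoˡ-≤ (e + d) 1≤t)))

  less : n ≡ 2 * k → extensions w k (suc t) + extensions w k 0 < (n ∸ t) C (k ∸ t)
  less n≡2k = subst₂ _<_ (sym size≡) (sym pencil≡) (ℕ.+-monoʳ-< (w C e)
    (subst (_< w C suc e) (sym (trans (wCk≡ 0 2k+0≡n) (cong (w C_) (ℕ.+-identityʳ e))))
      (C-mono-< (ℕ.n<1+n e) (beyond 0 2k+0≡n (arith e)))))
    where
    2k+0≡n : 2 * k + 0 ≡ n
    2k+0≡n = trans (ℕ.+-identityʳ (2 * k)) (sym n≡2k)
    arith : ∀ e → e + suc e ≡ suc e + (e + 0)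
    arith = solve-∀

  twice : n ≡ 2 * k → extensions w k (suc t) + extensions w k 0 ≡ 2 * ((2 * k ∸ t ∸ 1) C k)
  twice n≡2k = trans size≡ (trans
    (cong (_+ w C k) (sym (trans (wCk≡ 0 2k+0≡n) (cong (w C_) (ℕ.+-identityʳ e)))))
    (trans (cong (_+_ (w C k)) (sym (ℕ.+-identityʳ (w C k))))
      (cong (λ m → 2 * (m C k)) (sym (∸-∸-≡ t 1
        (trans (cong (_+ w) (ℕ.+-comm t 1)) (trans 1+t+w≡n n≡2k)))))))
    where
    2k+0≡n : 2 * k + 0 ≡ n
    2k+0≡n = trans (ℕ.+-identityʳ (2 * k)) (sym n≡2k)

  equal : n ≡ 2 * k + 1 → extensions w k (suc t) + extensions w k 0 ≡ (n ∸ t) C (k ∸ t)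
  equal n≡2k+1 = trans size≡ (trans (cong (_+_ (w C e)) (trans (wCk≡ 1 (sym n≡2k+1))
    (cong (w C_) (ℕ.+-comm e 1)))) (sym pencil≡))

  greater : ∀ d → 2 * k + suc (suc d) ≡ n → (n ∸ t) C (k ∸ t) < extensions w k (suc t) + extensions w k 0
  greater d 2k+2+d≡n = subst₂ _<_ (sym pencil≡) (sym size≡) (ℕ.+-monoʳ-< (w C e)
    (subst (w C suc e <_) (sym (wCk≡ (suc (suc d)) 2k+2+d≡n))
      (C-mono-< (subst (suc e <_) (sym (ℕ.+-comm e (suc (suc d)))) (s≤s (s≤s (ℕ.m≤n+m e d))))
        (beyond (suc (suc d)) 2k+2+d≡n refl))))

SamePair-size : ∀ {i j a b} w k → SamePair i j a b →
  extensions w k i + extensions w k j ≡ extensions w k a + extensions w k b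
SamePair-size w k (inj₁ (refl , refl)) = refl
SamePair-size {i} {j} w k (inj₂ (refl , refl)) = ℕ.+-comm (extensions w k i) (extensions w k j)

SamePair-sum : ∀ {i j a b} → SamePair i j a b → i + j ≡ a + b
SamePair-sum (inj₁ (refl , refl)) = refl
SamePair-sum {i} {j} (inj₂ (refl , refl)) = ℕ.+-comm i j

-- Matching the comparison with the cases (i) to (iv).

module Cases {n k t i j w : ℕ} (2k≤n : 2 * k ≤ n) (1≤t : 1 ≤ t) (t<k : t < k)
  (i+j+w≡n : i + j + w ≡ n) where

  size# pencil# : ℕ
  size#   = extensions w k i + extensions w k j
  pencil# = (n ∸ t) C (k ∸ t)

  module _ (n≡2k : n ≡ 2 * k) where

    -- The lower indices k - i and k - j add up to w, so the two summands agree by symmetry.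
    antipodal-size : i ≤ k → j ≤ k → size# ≡ 2 * ((2 * k ∸ i ∸ j) C (k ∸ i))
    antipodal-size i≤k j≤k with ℕ.m≤n⇒∃[o]m+o≡n i≤k | ℕ.m≤n⇒∃[o]m+o≡n j≤k
    ... | b , i+b≡k | a , j+a≡k = begin
      extensions w k i + extensions w k j
        ≡⟨ cong₂ _+_ (extensions-≡ w i b (sym i+b≡k)) (extensions-≡ w j a (sym j+a≡k)) ⟩
      w C b + w C a
        ≡⟨ cong (_+_ (w C b)) (C-sym a b a+b≡w) ⟩
      w C b + w C b
        ≡⟨ cong (_+_ (w C b)) (sym (ℕ.+-identityʳ (w C b))) ⟩
      2 * (w C b)
        ≡⟨ cong₂ (λ m l → 2 * (m C l)) (sym (∸-∸-≡ i j (trans i+j+w≡n n≡2k)))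
             (trans (sym (ℕ.m+n∸m≡n i b)) (cong (_∸ i) i+b≡k)) ⟩
      2 * ((2 * k ∸ i ∸ j) C (k ∸ i)) ∎
      where
      open ≡-Reasoning
      arith : ∀ i j a b → i + j + (a + b) ≡ i + b + (j + a)
      arith = solve-∀
      a+b≡w : a + b ≡ w
      a+b≡w = ℕ.+-cancelˡ-≡ (i + j) _ _ (trans (arith i j a b) (trans
        (cong₂ _+_ i+b≡k (trans j+a≡k (sym (ℕ.+-identityʳ k)))) (sym (trans i+j+w≡n n≡2k))))

    -- This is the origin of (k + 1)/2 in the cases: twice a binomial coefficient is compared with k
    -- + 1.
    antipodal-pencil : k ≡ suc t → pencil# ≡ suc k
    antipodal-pencil refl = trans
      (pencil-≡ t (trans n≡2k (arith t)) (ℕ.+-comm 1 t)) (nC1≡n (suc k))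
      where
      arith : ∀ t → 2 * suc t ≡ t + suc (suc t)
      arith = solve-∀

    -- When one of the two sets has k = n/2 points, each summand counts a single k-set: that set or
    -- its complement.
    full-size : ∀ {ℓ} → ℓ ≤ k → SamePair i j k ℓ → size# ≡ 2
    full-size {ℓ} ℓ≤k same = trans (SamePair-size w k same) (cong₂ _+_
      (trans (extensions-≡ w k 0 (sym (ℕ.+-identityʳ k))) (nC0≡1 w))
      (trans (extensions-≡ w ℓ w k≡) (nCn≡1 w)))
      where
      k≡ : k ≡ ℓ + w
      k≡ = ℕ.+-cancelˡ-≡ k _ _ (trans (cong (_+_ k) (sym (ℕ.+-identityʳ k)))
        (trans (sym (trans i+j+w≡n n≡2k)) (trans (cong (_+ w) (SamePair-sum same)) (ℕ.+-assoc k ℓ w))))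

    full-less : k ≡ suc t → size# ≡ 2 → size# < pencil#
    full-less k≡1+t size≡2 = subst₂ _<_ (sym size≡2) (sym (antipodal-pencil k≡1+t))
      (s≤s (subst (2 ≤_) (sym k≡1+t) (s≤s 1≤t)))

  t+1≡ : t + 1 ≡ suc t
  t+1≡ = ℕ.+-comm t 1

  extreme-sum : SamePair i j (t + 1) 0 → suc t + w ≡ n
  extreme-sum same = trans (cong (_+ w) (sym (trans (SamePair-sum same)
    (trans (ℕ.+-identityʳ (t + 1)) t+1≡)))) i+j+w≡n

  extreme-size : SamePair i j (t + 1) 0 → size# ≡ extensions w k (suc t) + extensions w k 0
  extreme-size same = trans (SamePair-size w k same) (cong (λ a → extensions w k a + extensions w k 0) t+1≡)

  full-alternative : n ≡ 2 * k → Alternative-i n k t i j → size# ≡ 2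
  full-alternative n≡2k (k≡t+1 , ℓ , ℓ≤ , same) = full-size n≡2k (subst (ℓ ≤_) (sym k≡t+1) ℓ≤)
    (subst (λ a → SamePair i j a ℓ) (sym k≡t+1) same)

  case-i-less : Case-i n k t i j → size# < pencil#
  case-i-less (_ , n≡2k , inj₁ same) = subst (_< pencil#) (sym (extreme-size same))
    (Extreme.less 1≤t t<k (extreme-sum same) n≡2k)
  case-i-less (_ , n≡2k , inj₂ alt@(k≡t+1 , _)) =
    full-less n≡2k (trans k≡t+1 t+1≡) (full-alternative n≡2k alt)

  case-i-size : Case-i n k t i j → size# ≡ 2 * ((2 * k ∸ t ∸ 1) C k)
  case-i-size (_ , n≡2k , inj₁ same) =
    trans (extreme-size same) (Extreme.twice 1≤t t<k (extreme-sum same) n≡2k)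
  case-i-size (_ , n≡2k , inj₂ alt@(k≡t+1 , _)) = trans (full-alternative n≡2k alt)
    (cong (2 *_) (sym (trans (cong (_C k) (∸-∸-≡ t 1 (cong₂ _+_ (sym k≡t+1) (sym (ℕ.+-identityʳ k)))))
      (nCn≡1 k))))

  case-i-size₂ : Case-i n k t i j → k ≡ t + 1 → size# ≡ 2
  case-i-size₂ (_ , n≡2k , inj₁ same) k≡t+1 =
    full-alternative n≡2k (k≡t+1 , 0 , z≤n , same)
  case-i-size₂ (_ , n≡2k , inj₂ alt)  k≡t+1 = full-alternative n≡2k alt

  ≤∸1⇒≤ : ∀ {l} → l ≤ k ∸ 1 → l ≤ k
  ≤∸1⇒≤ p = ℕ.≤-trans p (ℕ.m∸n≤m k 1)

  case-ii-size : Case-ii n k t i j → size# ≡ 2 * ((2 * k ∸ i ∸ j) C (k ∸ i))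
  case-ii-size (_ , n≡2k , _ , (_ , i<k) , (_ , j<k) , _) =
    antipodal-size n≡2k (≤∸1⇒≤ i<k) (≤∸1⇒≤ j<k)

  case-ii-less : Case-ii n k t i j → size# < pencil#
  case-ii-less c@(_ , n≡2k , k≡t+1 , _ , _ , _ , C<) = subst₂ _<_
    (trans (ℕ.*-comm ((2 * k ∸ i ∸ j) C (k ∸ i)) 2) (sym (case-ii-size c)))
    (trans (ℕ.*-identityʳ (k + 1)) (trans (ℕ.+-comm k 1) (sym (antipodal-pencil n≡2k (trans k≡t+1 t+1≡)))))
    (/-<⇒ {(2 * k ∸ i ∸ j) C (k ∸ i)} {1} {k + 1} {2} C<)

  case-iii-equal : Case-iii n k t i j → size# ≡ pencil#
  case-iii-equal (_ , _ , n≡2k+1 , same) =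
    trans (extreme-size same) (Extreme.equal 1≤t t<k (extreme-sum same) n≡2k+1)

  case-iv-equal : Case-iv n k t i j → size# ≡ pencil#
  case-iv-equal (_ , n≡2k , k≡t+1 , (_ , i<k) , (_ , j<k) , _ , C≡) = begin
    size#
      ≡⟨ antipodal-size n≡2k (≤∸1⇒≤ i<k) (≤∸1⇒≤ j<k) ⟩
    2 * ((2 * k ∸ i ∸ j) C (k ∸ i))
      ≡⟨ ℕ.*-comm 2 ((2 * k ∸ i ∸ j) C (k ∸ i)) ⟩
    ((2 * k ∸ i ∸ j) C (k ∸ i)) * 2
      ≡⟨ /-≡⇒ {(2 * k ∸ i ∸ j) C (k ∸ i)} {1} {k + 1} {2} C≡ ⟩
    (k + 1) * 1
      ≡⟨ trans (ℕ.*-identityʳ (k + 1)) (ℕ.+-comm k 1) ⟩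
    suc k
      ≡⟨ antipodal-pencil n≡2k (trans k≡t+1 t+1≡) ⟨
    pencil# ∎
    where open ≡-Reasoning

  -- Each outcome of the comparison carries the cases responsible for it. As the outcomes exclude
  -- one another, a single case analysis yields the "only if" halves of both equivalences.
  data Verdict : Set where
    less    : size# < pencil# → Case-i n k t i j ⊎ Case-ii n k t i j → Verdict
    equal   : size# ≡ pencil# → Case-iii n k t i j ⊎ Case-iv n k t i j → Verdict
    greater : pencil# < size# → Verdict

  verdict-less : Verdict → size# < pencil# → Case-i n k t i j ⊎ Case-ii n k t i j
  verdict-less (less _ c)   _  = c
  verdict-less (equal eq _) lt = contradiction eq (ℕ.<⇒≢ lt)
  verdict-less (greater gt) lt = contradiction gt (ℕ.<-asym lt)

  verdict-equal : Verdict → size# ≡ pencil# → Case-iii n k t i j ⊎ Case-iv n k t i j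
  verdict-equal (less lt _)  eq = contradiction eq (ℕ.<⇒≢ lt)
  verdict-equal (equal _ c)  _  = c
  verdict-equal (greater gt) eq = contradiction (sym eq) (ℕ.<⇒≢ gt)

  extreme-verdict : 2 ∣ t → SamePair i j (t + 1) 0 → Verdict
  -- The excess n - 2k decides the outcome.
  extreme-verdict 2∣t same with ℕ.m≤n⇒∃[o]m+o≡n 2k≤n
  ... | zero        , eq = less (case-i-less c) (inj₁ c)
    where
    c : Case-i n k t i j
    c = 2∣t , trans (sym eq) (ℕ.+-identityʳ (2 * k)) , inj₁ same
  ... | suc zero    , eq = equal (case-iii-equal c) (inj₁ c)
    where
    c : Case-iii n k t i j
    c = 2∣t , ℕ.<⇒≤ t<k , sym eq , same
  ... | suc (suc d) , eq = greater (subst (pencil# <_) (sym (extreme-size same))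
    (Extreme.greater 1≤t t<k (extreme-sum same) d eq))

  antipodal-verdict : n ≡ 2 * k → k ≡ suc t → 2 ∣ t → k < i + j → i ≤ k → j ≤ k → Verdict
  antipodal-verdict n≡2k k≡1+t 2∣t k<i+j i≤k j≤k with ℕ.m≤n⇒m<n∨m≡n i≤k | ℕ.m≤n⇒m<n∨m≡n j≤k
  -- A set of full size k = t + 1 is an alternative representation of case (i), the other size being
  -- ℓ.
  ... | inj₂ refl | _ = less (case-i-less c) (inj₁ c)
    where
    c : Case-i n k t i j
    c = 2∣t , n≡2k , inj₂ (trans k≡1+t (sym t+1≡) , j ,
      subst (j ≤_) (trans k≡1+t (sym t+1≡)) j≤k , inj₁ (trans k≡1+t (sym t+1≡) , refl))
  ... | inj₁ _ | inj₂ refl = less (case-i-less c) (inj₁ c)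
    where
    c : Case-i n k t i j
    c = 2∣t , n≡2k , inj₂ (trans k≡1+t (sym t+1≡) , i ,
      subst (i ≤_) (trans k≡1+t (sym t+1≡)) i≤k , inj₂ (refl , trans k≡1+t (sym t+1≡)))
  ... | inj₁ i<k | inj₁ j<k = compare (ℕ.<-cmp (C# * 2) ((k + 1) * 1))
    where
    C# : ℕ
    C# = (2 * k ∸ i ∸ j) C (k ∸ i)
    k≡t+1 : k ≡ t + 1
    k≡t+1 = trans k≡1+t (sym t+1≡)
    size≡ : size# ≡ C# * 2
    size≡ = trans (antipodal-size n≡2k i≤k j≤k) (ℕ.*-comm 2 C#)
    pencil≡ : pencil# ≡ (k + 1) * 1
    pencil≡ = trans (antipodal-pencil n≡2k k≡1+t) (sym (trans (ℕ.*-identityʳ (k + 1)) (ℕ.+-comm k 1)))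
    1≤ : ∀ {a b} → k < a + b → b ≤ k → 1 ≤ a
    1≤ {zero}  k<b b≤k = contradiction b≤k (ℕ.<⇒≱ k<b)
    1≤ {suc a} _   _   = s≤s z≤n
    ranges : (1 ≤ i × i ≤ k ∸ 1) × (1 ≤ j × j ≤ k ∸ 1)
    ranges = (1≤ k<i+j j≤k , ℕ.<⇒≤pred i<k) , (1≤ (subst (k <_) (ℕ.+-comm i j) k<i+j) i≤k , ℕ.<⇒≤pred j<k)
    compare : Tri (C# * 2 < (k + 1) * 1) (C# * 2 ≡ (k + 1) * 1) ((k + 1) * 1 < C# * 2) → Verdict
    compare (tri< lt _ _) = less (subst₂ _<_ (sym size≡) (sym pencil≡) lt)
      (inj₂ (2∣t , n≡2k , k≡t+1 , proj₁ ranges , proj₂ ranges , k<i+j , /-<⇐ {C#} {1} {k + 1} {2} lt))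
    compare (tri≈ _ eq _) = equal (trans size≡ (trans eq (sym pencil≡)))
      (inj₂ (2∣t , n≡2k , k≡t+1 , proj₁ ranges , proj₂ ranges , ℕ.<⇒≤ k<i+j , /-≡⇐ {C#} {1} {k + 1} {2} eq))
    compare (tri> _ _ gt) = greater (subst₂ _<_ (sym pencil≡) (sym size≡) gt)

verdict : ∀ {n k t i j w} (2k≤n : 2 * k ≤ n) (1≤t : 1 ≤ t) (t<k : t < k) (s : i + j + w ≡ n) →
  Shape n k t i j → Cases.Verdict 2k≤n 1≤t t<k s
verdict {i = i} {j} {w} 2k≤n 1≤t t<k s (low i+j≤t) =
  Cases.greater {i = i} {j} {w} {2k≤n} {1≤t} {t<k} {s} (low⇒> {i = i} {j} s 2k≤n t<k i+j≤t)
verdict {t = t} {zero} 2k≤n 1≤t t<k s (critical j≡1+t 2∣t) =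
  Cases.extreme-verdict 2k≤n 1≤t t<k s 2∣t (inj₂ (refl , trans j≡1+t (ℕ.+-comm 1 t)))
verdict {t = t} {suc i} {zero} 2k≤n 1≤t t<k s (critical i+0≡1+t 2∣t) =
  Cases.extreme-verdict 2k≤n 1≤t t<k s 2∣t
    (inj₁ (trans (sym (ℕ.+-identityʳ (suc i))) (trans i+0≡1+t (ℕ.+-comm 1 t)) , refl))
-- With i + j = t + 1, only a pair with a zero can be exceptional; two positive sizes always exceed
-- the pencil.
verdict {i = suc i} {suc j} {w} 2k≤n 1≤t t<k s (critical i+j≡1+t _) =
  Cases.greater {i = suc i} {suc j} {w} {2k≤n} {1≤t} {t<k} {s} (critical⇒> i j s 2k≤n t<k i+j≡1+t)
verdict 2k≤n 1≤t t<k s (antipodal n≡2k k≡1+t 2∣t k<i+j i≤k j≤k) =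
  Cases.antipodal-verdict 2k≤n 1≤t t<k s n≡2k k≡1+t 2∣t k<i+j i≤k j≤k

-- Independence of the second set when one has size k and n = 2k.

⊆∧∣≡∣⇒⊇ : ∀ {n} {p q : Subset n} → p ⊆ q → ∣ p ∣ ≡ ∣ q ∣ → q ⊆ p
⊆∧∣≡∣⇒⊇ {p = p} p⊆q ∣p∣≡∣q∣ {x} x∈q with x ∈? p
... | yes x∈p = x∈p
... | no x∉p  = contradiction ∣p∣≡∣q∣ (ℕ.<⇒≢ (p⊂q⇒∣p∣<∣q∣ (p⊆q , x , x∈q , x∉p)))

disjoint⇒⊆∁ : ∀ {n} {I J : Subset n} → Disjoint I J → I ⊆ ∁ J
disjoint⇒⊆∁ dis x∈I = x∉p⇒x∈∁p (λ x∈J → dis (_ , x∈p∩q⁺ (x∈I , x∈J)))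

disjoint⇒⊆∁-sym : ∀ {n} {I J : Subset n} → Disjoint I J → J ⊆ ∁ I
disjoint⇒⊆∁-sym dis x∈J = x∉p⇒x∈∁p (λ x∈I → dis (_ , x∈p∩q⁺ (x∈I , x∈J)))

module _ {n k : ℕ} {A B : Subset n} (A⊆B : A ⊆ B) (K : KSubset n k) where

  -- A k-set containing A must be A itself, so the upper inclusion comes for free.
  between-lower : ∣ A ∣ ≡ k → between A B K ≡ (A ⊆ᵇ proj₁ K)
  between-lower ∣A∣≡k with A ⊆? proj₁ K
  ... | no _    = refl
  ... | yes A⊆K = dec-true (proj₁ K ⊆? B)
    (λ x∈K → A⊆B (⊆∧∣≡∣⇒⊇ A⊆K (trans ∣A∣≡k (sym (proj₂ K))) x∈K))

  between-upper : ∣ B ∣ ≡ k → between A B K ≡ (proj₁ K ⊆ᵇ B)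
  between-upper ∣B∣≡k with proj₁ K ⊆? B
  ... | no _    = ∧-zeroʳ (A ⊆ᵇ proj₁ K)
  ... | yes K⊆B = trans (∧-identityʳ (A ⊆ᵇ proj₁ K)) (dec-true (A ⊆? proj₁ K)
    (λ x∈A → ⊆∧∣≡∣⇒⊇ K⊆B (trans (proj₂ K) (sym ∣B∣≡k)) (A⊆B x∈A)))

paired-cong : ∀ {n k} (I J I′ J′ : Subset n) (K : KSubset n k) →
  between I (∁ J) K ≡ between I′ (∁ J′) K → between J (∁ I) K ≡ between J′ (∁ I′) K →
  paired k I J K ≈ paired k I′ J′ K
paired-cong {k = k} I J I′ J′ K p q ε 0<ε = 0 , λ N _ → subst (ℚ._< ε)
  (sym (trans (cong (λ r → ℚ.∣ r ℚ.- seq (paired k I′ J′ K) N ∣) (same N))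
    (cong ℚ.∣_∣ (ℚ.+-inverseʳ (seq (paired k I′ J′ K) N))))) 0<ε
  where
  same : ∀ N → seq (paired k I J K) N ≡ seq (paired k I′ J′ K) N
  same N = cong₂ (λ a b → seq (if a then 1ℝ else 0ℝ) N ℚ.+ seq (if b then 1ℝ else 0ℝ) N) p q

∣∁∣≡ : ∀ {n k} (I : Subset n) → n ≡ 2 * k → ∣ I ∣ ≡ k → ∣ ∁ I ∣ ≡ k
∣∁∣≡ {k = k} I n≡2k ∣I∣≡k = trans (∣∁p∣≡n∸∣p∣ I)
  (trans (cong₂ _∸_ n≡2k ∣I∣≡k) (trans (ℕ.m+n∸m≡n k (k + 0)) (ℕ.+-identityʳ k)))

-- Since ∁ I also has size k, one summand detects K = I and the other K = ∁ I, whatever J is.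
paired-full-left : ∀ {n k} → n ≡ 2 * k → ∀ (I J J′ : Subset n) → ∣ I ∣ ≡ k →
  Disjoint I J → Disjoint I J′ → paired k I J′ ≗ℝ paired k I J
paired-full-left n≡2k I J J′ ∣I∣≡k dis dis′ K = paired-cong I J′ I J K
  (trans (between-lower (disjoint⇒⊆∁ dis′) K ∣I∣≡k) (sym (between-lower (disjoint⇒⊆∁ dis) K ∣I∣≡k)))
  (trans (between-upper (disjoint⇒⊆∁-sym dis′) K ∣∁I∣≡k) (sym (between-upper (disjoint⇒⊆∁-sym dis) K ∣∁I∣≡k)))
  where ∣∁I∣≡k = ∣∁∣≡ I n≡2k ∣I∣≡k

paired-full-right : ∀ {n k} → n ≡ 2 * k → ∀ (I I′ J : Subset n) → ∣ J ∣ ≡ k →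
  Disjoint I J → Disjoint I′ J → paired k I′ J ≗ℝ paired k I J
paired-full-right n≡2k I I′ J ∣J∣≡k dis dis′ K = paired-cong I′ J I J K
  (trans (between-upper (disjoint⇒⊆∁ dis′) K ∣∁J∣≡k) (sym (between-upper (disjoint⇒⊆∁ dis) K ∣∁J∣≡k)))
  (trans (between-lower (disjoint⇒⊆∁-sym dis′) K ∣J∣≡k) (sym (between-lower (disjoint⇒⊆∁-sym dis) K ∣J∣≡k)))
  where ∣∁J∣≡k = ∣∁∣≡ J n≡2k ∣J∣≡k

≤∸1⇒< : ∀ {t k} → 1 ≤ t → t ≤ k ∸ 1 → t < k
-- For k = 0 the truncated difference k ∸ 1 is 0, which contradicts 1 ≤ t.
≤∸1⇒< {k = zero}  1≤t t≤0 = contradiction (ℕ.≤-trans 1≤t t≤0) λ ()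
≤∸1⇒< {k = suc k} 1≤t t≤k = s≤s t≤k

theorem4 : ∀ (n k t i j : ℕ) (I J : Subset n) →
    2 * k ≤ n →
    1 ≤ t → t ≤ k ∸ 1 →
    Disjoint I J → ∣ I ∣ ≡ i → ∣ J ∣ ≡ j →
    HasDegree (paired k I J) [ t ] →
    (size (paired k I J) <ℝ fromℕ ((n ∸ t) C (k ∸ t))
    ⇔ (Case-i n k t i j ⊎ Case-ii n k t i j))
    × (Case-i n k t i j →
    size (paired k I J) ≈ fromℕ (2 * ((2 * k ∸ t ∸ 1) C k))
    × (k ≡ t + 1 →
    size (paired k I J) ≈ fromℕ 2
    × (i ≡ t + 1 → ∀ J′ → Disjoint I J′ → paired k I J′ ≗ℝ paired k I J)
    × (j ≡ t + 1 → ∀ I′ → Disjoint I′ J → paired k I′ J ≗ℝ paired k I J)))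
    × (Case-ii n k t i j →
    size (paired k I J) ≈ fromℕ (2 * ((2 * k ∸ i ∸ j) C (k ∸ i))))
    × (size (paired k I J) ≈ fromℕ ((n ∸ t) C (k ∸ t))
    ⇔ (Case-iii n k t i j ⊎ Case-iv n k t i j))
theorem4 n k t i j I J 2k≤n 1≤t t≤k∸1 dis refl refl (p≢0 , comb , _) =
    mk⇔ (λ p< → verdict-less v (<ℝ⇒< {p#} {size#} size≡ {pencil#} p<))
      (λ c → <⇒<ℝ {p#} {size#} size≡ {pencil#} ([ case-i-less , case-ii-less ]′ c))
  , (λ c → ≡⇒≈ {p#} {size#} size≡ (case-i-size c) , λ k≡t+1 →
        ≡⇒≈ {p#} {size#} size≡ (case-i-size₂ c k≡t+1)
      , (λ i≡t+1 J′ → paired-full-left (proj₁ (proj₂ c)) I J J′ (trans i≡t+1 (sym k≡t+1)) dis)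
      , (λ j≡t+1 I′ → paired-full-right (proj₁ (proj₂ c)) I I′ J (trans j≡t+1 (sym k≡t+1)) dis))
  , (λ c → ≡⇒≈ {p#} {size#} size≡ (case-ii-size c))
  , mk⇔ (λ p≈ → verdict-equal v (≈⇒≡ {p#} {size#} size≡ {pencil#} p≈))
      (λ c → ≡⇒≈ {p#} {size#} size≡ ([ case-iii-equal , case-iv-equal ]′ c))
  where
  w : ℕ
  w = proj₁ (split I J dis)
  σ : Split I J (∣ I ∣) (∣ J ∣) w
  σ = proj₂ (split I J dis)
  p# : ℝ
  p# = size (paired k I J)
  t<k : t < k
  t<k = ≤∸1⇒< 1≤t t≤k∸1
  open Cases {n} {k} {t} {∣ I ∣} {∣ J ∣} {w} 2k≤n 1≤t t<k (split-sum σ)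
  size≡ : ∀ N → seq p# N ≡ size# /1
  size≡ = seq-size σ k
  v : Verdict
  v = verdict 2k≤n 1≤t t<k (split-sum σ)
    (shape I J σ 2k≤n t<k p≢0 (deg≤⁺ {n} {k} {t} {I} {J} comb))
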